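{- Let $k = p_1p_2\cdots p_t \equiv 0 \pmod 4$, where $p_1,\dots,p_t$ are primes, not necessarily distinct; let $1 < i \leq t-1$, $r = p_1p_2\cdots p_i$ and $s = p_{i+1}p_{i+2}\cdots p_t$. If $u = rx+1$ for a positive integer $x \neq 2$, and $g$ is odd with $g \equiv s \pmod{2s}$, then there exists a $k$-ARCS of $K_u \times K_g$.
   Context: For graphs $G,H$, the tensor product $G \times H$ has vertex set $V(G)\times V(H)$, with $(g_1,h_1)$ adjacent to $(g_2,h_2)$ iff $g_1g_2 \in E(G)$ and $h_1h_2 \in E(H)$. $K_n$ is the complete graph on $n$ vertices. $K_u \times K_g$ is regarded as a $u$-partite graph with partite sets $V_j = \{j\}\times V(K_g)$. A partial $C_k$-factor of $K_u \times K_g$ is a subgraph which, for some $j$, is a spanning subgraph of $(K_u \times K_g)\setminus V_j$ all of whose components are cycles of length $k$. A $k$-ARCS of $K_u \times K_g$ is a partition of its edge set into partial $C_k$-factors. -}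

module Defs where

open import Data.Nat using (ℕ; zero; suc; _≤_)
open import Data.Fin using (Fin)
open import Data.Fin.Properties renaming (_≟_ to _≟ᶠ_)
open import Data.Product using (Σ; _×_; _,_; proj₁)
open import Data.Product.Properties using (≡-dec)
open import Data.Sum using (_⊎_)
open import Data.List using (List; []; _∷_; _++_; length; concat; filter; foldr)
open import Data.List.Relation.Unary.All using (All)
open import Data.List.Relation.Unary.Unique.Propositional using (Unique)
open import Relation.Binary.PropositionalEquality using (_≡_; _≢_)
open import Relation.Binary.Definitions using (DecidableEquality)
open import Relation.Nullary using (Dec; yes; no; ¬_)
open import Relation.Nullary.Decidable using (_×-dec_; _⊎-dec_)

-- Vertices of K_u × K_g : pairs (j , h), partite set V_j = {j} × V(K_g)
Vtx : ℕ → ℕ → Set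
Vtx u g = Fin u × Fin g

_≟ᵛ_ : ∀ {u g} → DecidableEquality (Vtx u g)
_≟ᵛ_ = ≡-dec _≟ᶠ_ _≟ᶠ_

Adj : ∀ {u g} → Vtx u g → Vtx u g → Set
Adj (a , b) (c , d) = (a ≢ c) × (b ≢ d)

pairs : ∀ {A : Set} → List A → List (A × A)
pairs (x ∷ y ∷ rest) = (x , y) ∷ pairs (y ∷ rest)
pairs _ = []

cycleEdges : ∀ {A : Set} → List A → List (A × A)
cycleEdges [] = []
cycleEdges (x ∷ xs) = pairs (x ∷ xs ++ x ∷ [])

IsCycle : ∀ {u g} → ℕ → List (Vtx u g) → Set
IsCycle k c = (length c ≡ k) × (3 ≤ k) × Unique c
              × All (λ e → Adj (Data.Product.proj₁ e) (Data.Product.proj₂ e)) (cycleEdges c)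

occ : ∀ {u g} → Vtx u g → List (Vtx u g) → ℕ
occ v xs = length (filter (λ w → v ≟ᵛ w) xs)

SameEdge : ∀ {u g} → Vtx u g → Vtx u g → Vtx u g × Vtx u g → Set
SameEdge x y (a , b) = ((x ≡ a) × (y ≡ b)) ⊎ ((x ≡ b) × (y ≡ a))

sameEdge? : ∀ {u g} (x y : Vtx u g) (e : Vtx u g × Vtx u g) → Dec (SameEdge x y e)
sameEdge? x y (a , b) = ((x ≟ᵛ a) ×-dec (y ≟ᵛ b)) ⊎-dec ((x ≟ᵛ b) ×-dec (y ≟ᵛ a))

record PartialFactor (k u g : ℕ) : Set where
  field
    hole   : Fin u
    cycles : List (List (Vtx u g))
    allCycles : All (IsCycle k) cycles
    holeUncovered : ∀ (v : Vtx u g) → proj₁ v ≡ hole → occ v (concat cycles) ≡ 0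
    restCovered   : ∀ (v : Vtx u g) → proj₁ v ≢ hole → occ v (concat cycles) ≡ 1

open PartialFactor public

factorEdges : ∀ {k u g} → PartialFactor k u g → List (Vtx u g × Vtx u g)
factorEdges F = concat (Data.List.map cycleEdges (cycles F))

edgeCount : ∀ {k u g} → Vtx u g → Vtx u g → List (PartialFactor k u g) → ℕ
edgeCount x y Fs =
  length (filter (sameEdge? x y) (concat (Data.List.map factorEdges Fs)))

-- A k-ARCS of K_u × K_g: a collection of partial C_k-factors partitioning the
-- edge set, i.e. every edge of K_u × K_g lies in exactly one of them
-- (cycle edges are edges of K_u × K_g by IsCycle).
record ARCS (k u g : ℕ) : Set where
  field
    factors   : List (PartialFactor k u g)
    partition : ∀ (x y : Vtx u g) → Adj x y → edgeCount x y factors ≡ 1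

{-# OPTIONS --safe #-}
module Submission where

-- Write r = 4y and let g = s q with s, q odd. Take V(K_g) = ℤ_s × ℤ_q and lift r-cycles of K_u to
-- K_u × K_g by voltages: an r-cycle a₀ b₀ a₁ b₁ … whose edges, directed from the a-end to the b-end,
-- carry the voltages f or f + (1,0) has net voltage (t,0), where t is the number of edges aᵢbᵢ of the
-- second kind (the edges bᵢaᵢ₊₁ are of the first kind). We arrange t = 2, a unit modulo s, so such a
-- cycle lifts to q cycles of length rs. The voltages f run through a half-set H of ℤ_s × ℤ_q for which
-- H + (1,0) is a half-set too, so the edges of K_u × K_g are partitioned as soon as every ordered pair
-- of points of K_u is once the (a-end, b-end) of an edge, with the same kind for both orders.
--
-- For u = rx + 1 the r-cycles live on x groups of size r and a point ∞. The near-factor missing a point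
-- c of group i contains a translate of Rosa's α-labelled cycle on group i ∪ {∞} ≅ ℤ_{r+1}, and, for each
-- arc j → σᵢ(j) of a near-derangement σᵢ of the groups other than i, a Hamiltonian cycle between a half
-- of group j and a half of group σᵢ(j). The halves come from an orthogonal array OA(4,3,2) indexed by
-- a proper 3-colouring of σᵢ; such σᵢ exist unless x = 2.
--
-- As the number of vertices and edges is right, coverage alone gives exactness.

open import Defs
open import Data.Bool using (Bool; true; false)
open import Data.Fin using (Fin; zero; suc; toℕ; fromℕ<; combine; remQuot; punchIn)
open import Data.Fin.Properties using (toℕ-injective; toℕ-fromℕ<; toℕ<n; all?; any?; punchIn-injective; punchInᵢ≢i; combine-injective; combine-injectiveˡ; combine-injectiveʳ; combine-surjective; combine-remQuot; remQuot-combine) renaming (_≟_ to _≟ᶠ_; suc-injective to sucᶠ-injective)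
open import Data.List using (List; []; _∷_; _++_; length; take; drop; concat; concatMap; map; filter; allFin; cartesianProduct)
open import Data.List.Membership.Propositional using (_∈_; _∉_)
open import Data.List.Membership.Propositional.Properties using (∈-∃++; ∈-map⁺; ∈-map⁻; ∈-++⁺ˡ; ∈-++⁺ʳ; ∈-allFin; ∈-cartesianProduct⁺; ∈-cartesianProduct⁻; ∈-concat⁺′)
open import Data.List.Properties using (length-map; length-++; length-tabulate; filter-none; filter-accept; filter-reject; filter-++; take++drop≡id)
open import Data.List.Relation.Binary.Permutation.Propositional using (_↭_; ↭-refl; ↭-trans; ↭-sym; prep; ↭⇒↭ₛ)
open import Data.List.Relation.Binary.Permutation.Propositional.Properties using (shift; ∈-resp-↭; ↭-length)
import Data.List.Relation.Binary.Permutation.Setoid.Properties as ↭ₛ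
open import Data.List.Relation.Unary.All as All using (All; []; _∷_)
import Data.List.Relation.Unary.All.Properties as Allₚ
open import Data.List.Relation.Unary.AllPairs using ([]; _∷_)
open import Data.List.Relation.Unary.Any using (here; there)
open import Data.List.Relation.Unary.Unique.Propositional using (Unique)
import Data.List.Relation.Unary.Unique.Propositional.Properties as Uniqueₚ
open import Data.Maybe using (Maybe; just; nothing)
open import Data.Maybe.Properties using (just-injective)
open import Data.Nat using (ℕ; zero; suc; _+_; _*_; _∸_; _/_; _%_; _≤_; _<_; z≤n; s≤s; z<s; _<?_; _≟_; NonZero; ≢-nonZero⁻¹)
open import Data.Nat.DivMod using (_mod_; m%n<n; m<n⇒m%n≡m; n%n≡0; [m+n]%n≡m%n; [m+kn]%n≡m%n; m*n%n≡0; m≡m%n+[m/n]*n; +-distrib-/-∣ʳ; m*n/n≡m; m<n⇒m/n≡0; n/n≡1)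
open import Data.Nat.Divisibility using (_∣_; divides; ∣m+n∣m⇒∣n; ∣m⇒∣m*n; n∣m*n; m∣m*n)
open import Data.Nat.ListAction using (product)
open import Data.Nat.ListAction.Properties using (product-++; product≢0)
open import Data.Nat.Primality using (Prime; prime⇒nonZero)
open import Data.Nat.Properties hiding (_≟_; _<?_)
open import Data.Nat.Tactic.RingSolver using (solve-∀)
open import Data.Product using (∃; ∃₂; _×_; _,_; proj₁; proj₂; swap)
open import Data.Product.Properties using (≡-dec; ,-injectiveˡ; ,-injectiveʳ)
open import Data.Sum using (_⊎_; inj₁; inj₂)
open import Function using (_∘_)
open import Relation.Binary.Definitions using (DecidableEquality; tri<; tri≈; tri>)
open import Relation.Binary.PropositionalEquality using (_≡_; _≢_; refl; sym; trans; cong; cong₂; subst; setoid; module ≡-Reasoning)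
open import Relation.Nullary using (Dec; yes; no; ¬_; contradiction)
open import Relation.Nullary.Decidable using (toWitness; _×-dec_; _→-dec_; ¬?)

-- Counting in lists

-- Pigeonhole: every member of `xs` uses up a position of `ys`, and equal lengths leave none over.
-- So `ys` is free of repetitions too, which turns coverage into exactness below.
Unique-⊆⇒↭ : ∀ {A : Set} {xs ys : List A} → Unique xs → (∀ {z} → z ∈ xs → z ∈ ys) →
             length ys ≡ length xs → ys ↭ xs
Unique-⊆⇒↭ {xs = []}     {[]}    _  _ _ = ↭-refl
Unique-⊆⇒↭ {xs = x ∷ xs} {ys} (x∉xs ∷ xs!) xs⊆ys eq with ∈-∃++ (xs⊆ys (here refl))
... | as , bs , refl = ↭-trans (shift x as bs) (prep x (Unique-⊆⇒↭ xs! incl len))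
  where
  moved : as ++ x ∷ bs ↭ x ∷ as ++ bs
  moved = shift x as bs
  incl : ∀ {z} → z ∈ xs → z ∈ as ++ bs
  incl z∈xs with ∈-resp-↭ moved (xs⊆ys (there z∈xs))
  ... | here refl = contradiction refl (All.lookup x∉xs z∈xs)
  ... | there z∈  = z∈
  len : length (as ++ bs) ≡ length xs
  len = suc-injective (trans (sym (↭-length moved)) eq)

Unique-resp-↭ : ∀ {A : Set} {xs ys : List A} → xs ↭ ys → Unique xs → Unique ys
Unique-resp-↭ p = ↭ₛ.Unique-resp-↭ (setoid _) (↭⇒↭ₛ p)

Unique-++⁻ : ∀ {A : Set} (xs : List A) {ys} → Unique (xs ++ ys) → Unique xs × Unique ys
Unique-++⁻ []       ys! = [] , ys!
Unique-++⁻ (x ∷ xs) (x∉ ∷ r!) with Unique-++⁻ xs r!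
... | xs! , ys! = (Allₚ.++⁻ˡ xs x∉ ∷ xs!) , ys!

Unique-concat⁻ : ∀ {A : Set} (xss : List (List A)) → Unique (concat xss) → All Unique xss
Unique-concat⁻ []         _ = []
Unique-concat⁻ (xs ∷ xss) u with Unique-++⁻ xs u
... | xs! , r! = xs! ∷ Unique-concat⁻ xss r!

module _ {A : Set} (_≟_ : DecidableEquality A) where

  count : A → List A → ℕ
  count v xs = length (filter (v ≟_) xs)

  count-∉ : ∀ {v xs} → v ∉ xs → count v xs ≡ 0
  count-∉ {v} v∉ = cong length (filter-none (v ≟_) (All.tabulate λ { w∈ refl → v∉ w∈ }))

  count-Unique : ∀ {v xs} → Unique xs → v ∈ xs → count v xs ≡ 1
  count-Unique {v} {x ∷ xs} (x∉ ∷ _) (here refl) =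
    trans (cong length (filter-accept (v ≟_) refl))
          (cong suc (count-∉ λ v∈ → All.lookup x∉ v∈ refl))
  count-Unique {v} {x ∷ xs} (x∉ ∷ xs!) (there v∈) =
    trans (cong length (filter-reject (v ≟_) (λ { refl → All.lookup x∉ v∈ refl })))
          (count-Unique xs! v∈)

length-concat : ∀ {A : Set} n (xss : List (List A)) → All (λ xs → length xs ≡ n) xss →
                length (concat xss) ≡ length xss * n
length-concat n []         []         = refl
length-concat n (xs ∷ xss) (eq ∷ eqs) =
  trans (length-++ xs) (cong₂ _+_ eq (length-concat n xss eqs))

length-× : ∀ {A B : Set} (xs : List A) (ys : List B) →
           length (cartesianProduct xs ys) ≡ length xs * length ys
length-× []       ys = refl
length-× (x ∷ xs) ys =
  trans (length-++ (map (x ,_) ys)) (cong₂ _+_ (length-map (x ,_) ys) (length-× xs ys))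

length-allFin : ∀ n → length (allFin n) ≡ n
length-allFin n = length-tabulate _

∈-concatMap : ∀ {A B : Set} (f : A → List B) {x xs y} → x ∈ xs → y ∈ f x → y ∈ concatMap f xs
∈-concatMap f x∈ y∈ = ∈-concat⁺′ y∈ (∈-map⁺ f x∈)

-- Partial factors and edge partitions from coverage and counting

AdjacentSteps : ∀ {u g} → List (Vtx u g) → Set
AdjacentSteps c = All (λ e → Adj (proj₁ e) (proj₂ e)) (cycleEdges c)

module _ {u g : ℕ} (hole : Fin (suc u)) where

  outside : List (Vtx (suc u) g)
  outside = cartesianProduct (map (punchIn hole) (allFin u)) (allFin g)

  outside-! : Unique outside
  outside-! = Uniqueₚ.cartesianProduct⁺ (Uniqueₚ.map⁺ (punchIn-injective hole _ _) (Uniqueₚ.allFin⁺ u)) (Uniqueₚ.allFin⁺ g)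

  length-outside : length outside ≡ u * g
  length-outside = trans (length-× (map (punchIn hole) (allFin u)) _)
    (cong₂ _*_ (trans (length-map (punchIn hole) (allFin u)) (length-allFin u)) (length-allFin g))

  ∈-outside⁻ : ∀ {v} → v ∈ outside → proj₁ v ≢ hole
  ∈-outside⁻ v∈ eq with ∈-map⁻ (punchIn hole) (proj₁ (∈-cartesianProduct⁻ (map (punchIn hole) (allFin u)) (allFin g) v∈))
  ... | j , _ , refl = punchInᵢ≢i hole j eq

  -- The cycles have together as many entries as there are vertices off the hole, so coverage makes
  -- `concat cs` a permutation of `outside`. Distinctness within each cycle and both occurrence
  -- counts follow.
  mkFactor : ∀ {k} → 3 ≤ k → (cs : List (List (Vtx (suc u) g))) →
             All (λ c → length c ≡ k) cs → All AdjacentSteps cs → length cs * k ≡ u * g →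
             (∀ v → proj₁ v ≢ hole → v ∈ concat cs) → PartialFactor k (suc u) g
  mkFactor {k} 3≤k cs len adj size cover = record
    { hole          = hole
    ; cycles        = cs
    ; allCycles     = All.zipWith (λ { (l , c! , a) → l , 3≤k , c! , a })
                        (len , All.zipWith (λ x → x) (Unique-concat⁻ cs cs! , adj))
    ; holeUncovered = λ v eq → count-∉ _≟ᵛ_ λ v∈ → ∈-outside⁻ (∈-resp-↭ perm v∈) eq
    ; restCovered   = λ v neq → count-Unique _≟ᵛ_ cs! (cover v neq)
    }
    where
    perm : concat cs ↭ outside
    perm = Unique-⊆⇒↭ outside-! (λ {z} z∈ → cover z (∈-outside⁻ z∈))
             (trans (length-concat k cs len) (trans size (sym length-outside)))
    cs! : Unique (concat cs)
    cs! = Unique-resp-↭ (↭-sym perm) outside-!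

module _ {u g : ℕ} where

  private
    V = Vtx (suc u) (suc g)
    ArcCode = (Fin (suc u) × Fin u) × (Fin (suc g) × Fin g)

  -- `punchIn a` enumerates the points other than `a`, so a plain product of finite sets codes the
  -- ordered adjacent pairs, each once.
  arc : ArcCode → V × V
  arc ((a , c) , (b , d)) = (a , b) , (punchIn a c , punchIn b d)

  arc-injective : ∀ {p q} → arc p ≡ arc q → p ≡ q
  arc-injective {(a , c) , (b , d)} {(a′ , c′) , (b′ , d′)} eq
    with ,-injectiveˡ (,-injectiveˡ eq) | ,-injectiveʳ (,-injectiveˡ eq)
  ... | refl | refl
    with punchIn-injective a c c′ (,-injectiveˡ (,-injectiveʳ eq))
       | punchIn-injective b d d′ (,-injectiveʳ (,-injectiveʳ eq))
  ... | refl | refl = refl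

  codes : List ArcCode
  codes = cartesianProduct (cartesianProduct (allFin (suc u)) (allFin u)) (cartesianProduct (allFin (suc g)) (allFin g))

  arcs : List (V × V)
  arcs = map arc codes

  arcs-! : Unique arcs
  arcs-! = Uniqueₚ.map⁺ arc-injective
    (Uniqueₚ.cartesianProduct⁺ (Uniqueₚ.cartesianProduct⁺ (Uniqueₚ.allFin⁺ _) (Uniqueₚ.allFin⁺ _))
                               (Uniqueₚ.cartesianProduct⁺ (Uniqueₚ.allFin⁺ _) (Uniqueₚ.allFin⁺ _)))

  length-arcs : length arcs ≡ (suc u * u) * (suc g * g)
  length-arcs = trans (length-map arc codes) (trans (length-× (cartesianProduct (allFin (suc u)) (allFin u)) _)
    (cong₂ _*_ (square (suc u) u) (square (suc g) g)))
    where
    square : ∀ m n → length (cartesianProduct (allFin m) (allFin n)) ≡ m * n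
    square m n = trans (length-× (allFin m) _) (cong₂ _*_ (length-allFin m) (length-allFin n))

  ∈-arcs⁻ : ∀ {x y} → (x , y) ∈ arcs → Adj x y
  ∈-arcs⁻ xy∈ with ∈-map⁻ arc xy∈
  ... | ((a , c) , (b , d)) , _ , refl = punchInᵢ≢i a c ∘ sym , punchInᵢ≢i b d ∘ sym

  flips : List (V × V) → List (V × V)
  flips E = E ++ map swap E

  _≟ᵃ_ : DecidableEquality (V × V)
  _≟ᵃ_ = ≡-dec _≟ᵛ_ _≟ᵛ_

  -- An unoriented match is a match with the edge or with its reversal, and never with both because
  -- `x ≢ y`.
  sameEdge-count : ∀ {x y} → x ≢ y → ∀ E →
    length (filter (sameEdge? x y) E) ≡ count _≟ᵃ_ (x , y) E + count _≟ᵃ_ (x , y) (map swap E)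
  sameEdge-count x≢y [] = refl
  sameEdge-count {x} {y} x≢y ((a , b) ∷ E) = go (x ≟ᵛ a) (y ≟ᵛ b) (x ≟ᵛ b) (y ≟ᵛ a)
    where
    P = sameEdge? x y
    Q = (x , y) ≟ᵃ_
    ih = sameEdge-count x≢y E
    rejects : ¬ SameEdge x y (a , b) →
      length (filter P ((a , b) ∷ E)) ≡ length (filter Q ((a , b) ∷ E)) + length (filter Q ((b , a) ∷ map swap E))
    rejects n = trans (cong length (filter-reject P n)) (trans ih (sym (cong₂ _+_
      (cong length (filter-reject Q (λ { refl → n (inj₁ (refl , refl)) })))
      (cong length (filter-reject Q (λ { refl → n (inj₂ (refl , refl)) }))))))
    go : Dec (x ≡ a) → Dec (y ≡ b) → Dec (x ≡ b) → Dec (y ≡ a) →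
      length (filter P ((a , b) ∷ E)) ≡ length (filter Q ((a , b) ∷ E)) + length (filter Q ((b , a) ∷ map swap E))
    go (yes refl) (yes refl) _ _ = trans (cong length (filter-accept P (inj₁ (refl , refl))))
      (trans (cong suc ih) (sym (cong₂ _+_ (cong length (filter-accept Q refl))
        (cong length (filter-reject Q (λ { refl → x≢y refl }))))))
    go _ _ (yes refl) (yes refl) = trans (cong length (filter-accept P (inj₂ (refl , refl))))
      (trans (cong suc ih) (sym (trans (cong₂ _+_ (cong length (filter-reject Q (λ { refl → x≢y refl })))
        (cong length (filter-accept Q refl))) (+-suc _ _))))
    -- One failing equation from each alternative of `SameEdge` refutes it; the four clauses are the
    -- four choices.
    go (no n) _ (no m) _ = rejects λ { (inj₁ (e , _)) → n e ; (inj₂ (e , _)) → m e }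
    go (no n) _ _ (no m) = rejects λ { (inj₁ (e , _)) → n e ; (inj₂ (_ , e)) → m e }
    go _ (no n) (no m) _ = rejects λ { (inj₁ (_ , e)) → n e ; (inj₂ (e , _)) → m e }
    go _ (no n) _ (no m) = rejects λ { (inj₁ (_ , e)) → n e ; (inj₂ (_ , e)) → m e }

  count-++ : ∀ e (E F : List (V × V)) → count _≟ᵃ_ e (E ++ F) ≡ count _≟ᵃ_ e E + count _≟ᵃ_ e F
  count-++ e E F = trans (cong length (filter-++ (e ≟ᵃ_) E F)) (length-++ (filter (e ≟ᵃ_) E))

  -- By the count `flips E` is as long as `arcs`, so coverage makes it a permutation of `arcs`: each
  -- ordered pair is met once among the edges and their reversals.
  mkARCS : ∀ {k} (Fs : List (PartialFactor k (suc u) (suc g))) →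
           length (concatMap factorEdges Fs) * 2 ≡ (suc u * u) * (suc g * g) →
           (∀ x y → Adj x y → (x , y) ∈ concatMap factorEdges Fs ⊎ (y , x) ∈ concatMap factorEdges Fs) →
           ARCS k (suc u) (suc g)
  mkARCS Fs size cover = record { factors = Fs ; partition = part }
    where
    E = concatMap factorEdges Fs
    within : ∀ {x y} → Adj x y → (x , y) ∈ flips E
    within {x} {y} xy with cover x y xy
    ... | inj₁ p = ∈-++⁺ˡ p
    ... | inj₂ p = ∈-++⁺ʳ E (∈-map⁺ swap p)
    len : length (flips E) ≡ length arcs
    len = begin
      length (flips E)              ≡⟨ length-++ E ⟩
      length E + length (map swap E) ≡⟨ cong (length E +_) (length-map swap E) ⟩
      length E + length E           ≡⟨ cong (length E +_) (sym (+-identityʳ (length E))) ⟩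
      2 * length E                  ≡⟨ *-comm 2 (length E) ⟩
      length E * 2                  ≡⟨ size ⟩
      (suc u * u) * (suc g * g)     ≡⟨ sym length-arcs ⟩
      length arcs                   ∎
      where open ≡-Reasoning
    flips! : Unique (flips E)
    flips! = Unique-resp-↭ (↭-sym (Unique-⊆⇒↭ arcs-! (λ {z} z∈ → within (∈-arcs⁻ z∈)) len)) arcs-!
    part : ∀ x y → Adj x y → edgeCount x y Fs ≡ 1
    part x y xy@(a≢ , _) = trans (sameEdge-count (λ { refl → a≢ refl }) E)
      (trans (sym (count-++ (x , y) E (map swap E))) (count-Unique _≟ᵃ_ flips! (within xy)))

even⊎odd : ∀ n → (∃ λ k → n ≡ 2 * k) ⊎ (∃ λ k → n ≡ suc (2 * k))
even⊎odd zero = inj₁ (0 , refl)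
even⊎odd (suc n) with even⊎odd n
... | inj₁ (k , refl) = inj₂ (k , refl)
... | inj₂ (k , refl) = inj₁ (suc k , sym (*-suc 2 k))

-- Arithmetic modulo M

module _ {M : ℕ} .{{_ : NonZero M}} where

  toℕ-mod : ∀ a → toℕ (a mod M) ≡ a % M
  toℕ-mod a = toℕ-fromℕ< (m%n<n a M)

  -- Adding multiples of `M` on both sides avoids subtraction in ℕ and leaves an equation for the
  -- ring solver.
  mod-cong : ∀ {a b} p q → a + p * M ≡ b + q * M → a mod M ≡ b mod M
  mod-cong {a} {b} p q eq = toℕ-injective (begin
    toℕ (a mod M)   ≡⟨ toℕ-mod a ⟩
    a % M           ≡⟨ sym ([m+kn]%n≡m%n a p M) ⟩
    (a + p * M) % M ≡⟨ cong (_% M) eq ⟩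
    (b + q * M) % M ≡⟨ [m+kn]%n≡m%n b q M ⟩
    b % M           ≡⟨ sym (toℕ-mod b) ⟩
    toℕ (b mod M)   ∎)
    where open ≡-Reasoning

  mod-cancel : ∀ {a b} → a mod M ≡ b mod M → ∃₂ λ p q → a + p * M ≡ b + q * M
  mod-cancel {a} {b} eq = b / M , a / M , (begin
    a + (b / M) * M                   ≡⟨ cong (_+ (b / M) * M) (m≡m%n+[m/n]*n a M) ⟩
    a % M + (a / M) * M + (b / M) * M ≡⟨ cong (λ r → r + (a / M) * M + (b / M) * M) (trans (sym (toℕ-mod a)) (trans (cong toℕ eq) (toℕ-mod b))) ⟩
    b % M + (a / M) * M + (b / M) * M ≡⟨ rearrange (b % M) ((a / M) * M) ((b / M) * M) ⟩
    b % M + (b / M) * M + (a / M) * M ≡⟨ cong (_+ (a / M) * M) (sym (m≡m%n+[m/n]*n b M)) ⟩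
    b + (a / M) * M                   ∎)
    where
    open ≡-Reasoning
    rearrange : ∀ x y z → x + y + z ≡ x + z + y
    rearrange = solve-∀

  mod-toℕ : ∀ (v : Fin M) → toℕ v mod M ≡ v
  mod-toℕ v = toℕ-injective (trans (toℕ-mod (toℕ v)) (m<n⇒m%n≡m (toℕ<n v)))

  mod-+ : ∀ {a b} c → a mod M ≡ b mod M → (a + c) mod M ≡ (b + c) mod M
  mod-+ {a} {b} c eq with mod-cancel {a} {b} eq
  ... | p , q , e = mod-cong p q (trans (swapʳ a c (p * M)) (trans (cong (_+ c) e) (swapʳ b (q * M) c)))
    where
    swapʳ : ∀ x y z → x + y + z ≡ x + z + y
    swapʳ = solve-∀

  mod-≢ : ∀ c {d} → 0 < d → d < M → (c + d) mod M ≢ c mod M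
  mod-≢ c {d} 0<d d<M eq with mod-cancel {c + d} {c} eq
  ... | p , q , e = contradiction zero≡d (<⇒≢ 0<d)
    where
    open ≡-Reasoning
    e′ : d + p * M ≡ q * M
    e′ = +-cancelˡ-≡ c _ _ (trans (sym (+-assoc c d (p * M))) e)
    zero≡d : 0 ≡ d
    zero≡d = begin
      0               ≡⟨ sym (m*n%n≡0 q M) ⟩
      (q * M) % M     ≡⟨ cong (_% M) (sym e′) ⟩
      (d + p * M) % M ≡⟨ [m+kn]%n≡m%n d p M ⟩
      d % M           ≡⟨ m<n⇒m%n≡m d<M ⟩
      d               ∎

  mod-reduce : ∀ z c → (z % M + c) mod M ≡ (z + c) mod M
  mod-reduce z c = mod-+ {z % M} {z} c (mod-cong (z / M) 0 (trans (sym (m≡m%n+[m/n]*n z M)) (sym (+-identityʳ z))))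

-- Modulo `suc M` the number `M * c` is the negative of `c`.
mod-subtract : ∀ {M} c (v : Fin (suc M)) → ∃ λ z → z < suc M × (z + c) mod suc M ≡ v
mod-subtract {M} c v = (toℕ v + M * c) % suc M , m%n<n (toℕ v + M * c) (suc M) ,
  trans (mod-reduce (toℕ v + M * c) c)
        (trans (mod-cong 0 c (eq (toℕ v) M c)) (mod-toℕ v))
  where
  eq : ∀ v M c → v + M * c + c + 0 ≡ v + c * suc M
  eq = solve-∀

-- `suc h` is the inverse of 2 and `2 * h * c` the negative of `c`. This is the form in which a net
-- voltage of 2 is seen to generate ℤ_s.
mod-halve : ∀ {h} c (v : Fin (suc (2 * h))) → ∃ λ k → k < suc (2 * h) × (2 * k + c) mod suc (2 * h) ≡ v
mod-halve {h} c v = z % s , m%n<n z s , trans (mod-cong (2 * (z / s)) (toℕ v + 2 * h * c + c) eq) (mod-toℕ v)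
  where
  s = suc (2 * h)
  z = (toℕ v + 2 * h * c) * suc h
  ring₁ : ∀ r d s c → 2 * r + c + (2 * d) * s ≡ 2 * (r + d * s) + c
  ring₁ = solve-∀
  ring₂ : ∀ v h c → 2 * ((v + 2 * h * c) * suc h) + c ≡ v + (v + 2 * h * c + c) * suc (2 * h)
  ring₂ = solve-∀
  eq : 2 * (z % s) + c + (2 * (z / s)) * s ≡ toℕ v + (toℕ v + 2 * h * c + c) * s
  eq = trans (ring₁ (z % s) (z / s) s c)
      (trans (cong (λ w → 2 * w + c) (sym (m≡m%n+[m/n]*n z s))) (ring₂ (toℕ v) h c))

-- Alternating closed walks

zigzag : ∀ {V : Set} → (ℕ → V) → (ℕ → V) → ℕ → List V
zigzag A B zero    = []
zigzag A B (suc n) = A 0 ∷ B 0 ∷ zigzag (A ∘ suc) (B ∘ suc) n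

module _ {V : Set} where

  -- The walk runs on to `A n` instead of returning to `A 0`, so it recurses on the shifted
  -- sequences; for a closed walk the two agree.
  openEdges : (A B : ℕ → V) → ℕ → List (V × V)
  openEdges A B n = pairs (zigzag A B n ++ A n ∷ [])

  openEdges-suc : ∀ (A B : ℕ → V) n →
    openEdges A B (suc n) ≡ (A 0 , B 0) ∷ (B 0 , A 1) ∷ openEdges (A ∘ suc) (B ∘ suc) n
  openEdges-suc A B zero    = refl
  openEdges-suc A B (suc n) = refl

  cycleEdges-zigzag : ∀ (A B : ℕ → V) n → A n ≡ A 0 → cycleEdges (zigzag A B n) ≡ openEdges A B n
  cycleEdges-zigzag A B zero    _  = refl
  cycleEdges-zigzag A B (suc n) eq = cong (λ v → pairs (zigzag A B (suc n) ++ v ∷ [])) (sym eq)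

  length-zigzag : ∀ (A B : ℕ → V) n → length (zigzag A B n) ≡ n * 2
  length-zigzag A B zero    = refl
  length-zigzag A B (suc n) = cong (2 +_) (length-zigzag (A ∘ suc) (B ∘ suc) n)

  length-openEdges : ∀ (A B : ℕ → V) n → length (openEdges A B n) ≡ n * 2
  length-openEdges A B zero    = refl
  length-openEdges A B (suc n) =
    trans (cong length (openEdges-suc A B n)) (cong (2 +_) (length-openEdges (A ∘ suc) (B ∘ suc) n))

  zigzag-A : ∀ (A B : ℕ → V) {n i} → i < n → A i ∈ zigzag A B n
  zigzag-A A B {suc n} {zero}  _         = here refl
  zigzag-A A B {suc n} {suc i} (s≤s i<n) = there (there (zigzag-A (A ∘ suc) (B ∘ suc) i<n))

  zigzag-B : ∀ (A B : ℕ → V) {n i} → i < n → B i ∈ zigzag A B n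
  zigzag-B A B {suc n} {zero}  _         = there (here refl)
  zigzag-B A B {suc n} {suc i} (s≤s i<n) = there (there (zigzag-B (A ∘ suc) (B ∘ suc) i<n))

  openEdges-AB : ∀ (A B : ℕ → V) {n i} → i < n → (A i , B i) ∈ openEdges A B n
  openEdges-AB A B {suc n} {zero}  _ = subst ((A 0 , B 0) ∈_) (sym (openEdges-suc A B n)) (here refl)
  openEdges-AB A B {suc n} {suc i} (s≤s i<n) = subst ((A (suc i) , B (suc i)) ∈_) (sym (openEdges-suc A B n))
    (there (there (openEdges-AB (A ∘ suc) (B ∘ suc) i<n)))

  openEdges-BA : ∀ (A B : ℕ → V) {n i} → i < n → (B i , A (suc i)) ∈ openEdges A B n
  openEdges-BA A B {suc n} {zero}  _ = subst ((B 0 , A 1) ∈_) (sym (openEdges-suc A B n)) (there (here refl))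
  openEdges-BA A B {suc n} {suc i} (s≤s i<n) = subst ((B (suc i) , A (suc (suc i))) ∈_) (sym (openEdges-suc A B n))
    (there (there (openEdges-BA (A ∘ suc) (B ∘ suc) i<n)))

  openEdges-All : ∀ {P : V × V → Set} (A B : ℕ → V) n →
    (∀ i → P (A i , B i)) → (∀ i → P (B i , A (suc i))) → All P (openEdges A B n)
  openEdges-All A B zero    p q = []
  openEdges-All {P} A B (suc n) p q = subst (All P) (sym (openEdges-suc A B n))
    (p 0 ∷ q 0 ∷ openEdges-All (A ∘ suc) (B ∘ suc) n (p ∘ suc) (q ∘ suc))

-- Cycle systems of K_u with edge types

⟦_⟧ : Bool → ℕ
⟦ true ⟧  = 1
⟦ false ⟧ = 0

sgn : ℕ → ℕ
sgn zero    = 0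
sgn (suc _) = 1

module Level (L : ℕ) .{{_ : NonZero L}} where

  -- In each round of L pairs exactly the edges a₀b₀ and a_{L-1}b_{L-1} have voltage f + (1,0);
  -- level n is the first coordinate reached at the n-th a-vertex of a lifted cycle.
  level : ℕ → ℕ
  level n = 2 * (n / L) + sgn (n % L)

  -- A round contains two edges of the second kind, so `k` rounds raise the level by `2 * k`.
  level-shift : ∀ i k → level (i + k * L) ≡ 2 * k + level i
  level-shift i k = trans (cong₂ (λ d r → 2 * d + sgn r)
      (trans (+-distrib-/-∣ʳ i (n∣m*n k)) (cong (i / L +_) (m*n/n≡m k L)))
      ([m+kn]%n≡m%n i k L))
    (ring (i / L) k (sgn (i % L)))
    where
    ring : ∀ d k r → 2 * (d + k) + r ≡ 2 * k + (2 * d + r)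
    ring = solve-∀

  level-< : ∀ {i} → i < L → level i ≡ sgn i
  level-< i<L = cong₂ (λ d r → 2 * d + sgn r) (m<n⇒m/n≡0 i<L) (m<n⇒m%n≡m i<L)

  level-L : level L ≡ 2
  level-L = cong₂ (λ d r → 2 * d + sgn r) (n/n≡1 L) (n%n≡0 L)

  -- The kind of the edge from the `i`-th a-vertex to the `i`-th b-vertex: the level rises by 1
  -- exactly where the voltage has the extra (1,0).
  Step : ℕ → Bool → Set
  Step i τ = level (suc i) ≡ level i + ⟦ τ ⟧

  step-first : 1 < L → Step 0 true
  step-first 1<L = trans (level-< 1<L) (cong (_+ 1) (sym (level-< (<⇒≤ 1<L))))

  step-inner : ∀ {i} → 0 < i → suc i < L → Step i false
  step-inner {suc i} _ i<L = trans (level-< i<L) (cong (_+ 0) (sym (level-< (<⇒≤ i<L))))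

  step-last : ∀ {i} → 0 < i → suc i ≡ L → Step i true
  step-last {suc i} _ eq = trans (trans (cong level eq) level-L) (cong (_+ 1) (sym (level-< (subst (suc i <_) eq ≤-refl))))

  step : 1 < L → ∀ {i} → i < L → ∃ (Step i)
  step 1<L {zero}  _   = true , step-first 1<L
  step 1<L {suc i} i<L with <-cmp (suc (suc i)) L
  ... | tri< p _ _ = false , step-inner z<s p
  ... | tri≈ _ p _ = true , step-last z<s p
  ... | tri> _ _ p = contradiction (<-≤-trans i<L (≤-pred p)) (<-irrefl refl)

  step-any : 1 < L → ∀ n → ∃ (Step n)
  step-any 1<L n with step 1<L (m%n<n n L)
  ... | τ , eq = τ , (begin
    level (suc n)                         ≡⟨ cong (level ∘ suc) n≡ ⟩
    level (suc (n % L) + (n / L) * L)     ≡⟨ level-shift (suc (n % L)) (n / L) ⟩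
    2 * (n / L) + level (suc (n % L))     ≡⟨ cong (2 * (n / L) +_) eq ⟩
    2 * (n / L) + (level (n % L) + ⟦ τ ⟧) ≡⟨ sym (+-assoc (2 * (n / L)) _ _) ⟩
    2 * (n / L) + level (n % L) + ⟦ τ ⟧   ≡⟨ cong (_+ ⟦ τ ⟧) (sym (level-shift (n % L) (n / L))) ⟩
    level (n % L + (n / L) * L) + ⟦ τ ⟧   ≡⟨ cong (λ m → level m + ⟦ τ ⟧) (sym n≡) ⟩
    level n + ⟦ τ ⟧                       ∎)
    where
    open ≡-Reasoning
    n≡ : n ≡ n % L + (n / L) * L
    n≡ = m≡m%n+[m/n]*n n L

-- Periodic sequences instead of lists: a lift can run round the cycle many times, and the closing
-- edge needs no special case. Distinctness of the vertices comes from counting.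
record Walk (V : Set) (L : ℕ) : Set where
  field
    A B        : ℕ → V
    A-periodic : ∀ i → A (i + L) ≡ A i
    B-periodic : ∀ i → B (i + L) ≡ B i
    A≢B        : ∀ i → A i ≢ B i
    B≢A        : ∀ i → B i ≢ A (suc i)

module _ {V : Set} {X L : ℕ} .{{_ : NonZero L}} (walk : V → Fin X → Walk V L) where

  open Level L

  Covers : V → V → Set
  Covers h v = ∃₂ λ κ i → i < L × (Walk.A (walk h κ) i ≡ v ⊎ Walk.B (walk h κ) i ≡ v)

  -- `v` is the a-end and `w` the b-end. The first alternative is an edge aᵢbᵢ, whose kind depends
  -- on its place; the second is an edge bᵢaᵢ₊₁, always of the first kind.
  Joins : V → V → Bool → Set
  Joins v w τ = ∃ λ h → ∃₂ λ κ i → i < L ×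
    ((Walk.A (walk h κ) i ≡ v × Walk.B (walk h κ) i ≡ w × Step i τ)
     ⊎ (Walk.A (walk h κ) (suc i) ≡ v × Walk.B (walk h κ) i ≡ w × τ ≡ false))

-- walk h κ, for κ : Fin X, are the cycles of the near-factor that misses h.
record Base (V : Set) (X L : ℕ) .{{_ : NonZero L}} : Set where
  field
    walk   : V → Fin X → Walk V L
    covers : ∀ h v → v ≢ h → Covers walk h v
    joins  : ∀ v w → v ≢ w → ∃ λ τ → Joins walk v w τ × Joins walk w v τ

-- Lifting a cycle system of K_u to K_u × K_g

module Lift {X L : ℕ} .{{_ : NonZero L}} (1<L : 1 < L) (base : Base (Fin (suc (X * (2 * L)))) X L) (h m : ℕ) where

  open Base base
  open Level L
  open module W o κ = Walk (walk o κ)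

  u s q : ℕ
  u = X * (2 * L)
  s = suc (2 * h)
  q = suc (2 * m)

  -- Indices of the half-set. `inj₁` gives the voltages (1,0), (3,0), ..., (2h-1,0): the odd
  -- residues below `s` form a half-set, and so do their successors. `inj₂` gives all voltages with
  -- second coordinate 1, ..., m, a set invariant under adding (1,0).
  Colour : Set
  Colour = Fin h ⊎ (Fin s × Fin m)

  f₁ f₂ : Colour → ℕ
  f₁ (inj₁ i)       = 2 * toℕ i + 1
  f₁ (inj₂ (i , _)) = toℕ i
  f₂ (inj₁ i)       = 0
  f₂ (inj₂ (_ , j)) = suc (toℕ j)

  colours : List Colour
  colours = map inj₁ (allFin h) ++ map inj₂ (cartesianProduct (allFin s) (allFin m))

  ∈-colours : ∀ f → f ∈ colours
  ∈-colours (inj₁ i) = ∈-++⁺ˡ (∈-map⁺ inj₁ (∈-allFin i))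
  ∈-colours (inj₂ (i , j)) = ∈-++⁺ʳ (map inj₁ (allFin h)) (∈-map⁺ inj₂ (∈-cartesianProduct⁺ (∈-allFin i) (∈-allFin j)))

  length-colours : length colours ≡ h + s * m
  length-colours = trans (length-++ (map inj₁ (allFin h))) (cong₂ _+_
    (trans (length-map inj₁ (allFin h)) (length-allFin h))
    (trans (length-map inj₂ (cartesianProduct (allFin s) (allFin m)))
      (trans (length-× (allFin s) (allFin m)) (cong₂ _*_ (length-allFin s) (length-allFin m)))))

  2*<s : ∀ (i : Fin h) → 2 * suc (toℕ i) < s
  2*<s i = s≤s (*-monoʳ-≤ 2 (toℕ<n i))

  f₂<q : ∀ (j : Fin m) → suc (toℕ j) < q
  f₂<q j = s≤s (≤-trans (toℕ<n j) (m≤m+n m _))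

  -- For either type τ, the voltages (f₁ f + ⟦ τ ⟧ , f₂ f) over all colours f form a half-set of ℤ_s × ℤ_q.
  record Link (τ : Bool) (f : Colour) (c : Fin s) (l : Fin q) (c′ : Fin s) (l′ : Fin q) : Set where
    constructor mkLink
    field
      shift₁ : (toℕ c + (f₁ f + ⟦ τ ⟧)) mod s ≡ c′
      shift₂ : (toℕ l + f₂ f) mod q ≡ l′

  -- No voltage is zero: in the first case the first coordinate lies between 1 and `2 * h`, in the
  -- second case the second one lies between 1 and `m`.
  Link-≢ : ∀ τ f {c l c′ l′} → Link τ f c l c′ l′ → combine c l ≢ combine c′ l′
  Link-≢ τ (inj₁ i) {c} {l} {c′} {l′} (mkLink e _) eq =
    mod-≢ (toℕ c) (<-≤-trans (s≤s z≤n) (≤-trans (m≤n+m 1 (2 * toℕ i)) (m≤m+n _ ⟦ τ ⟧)))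
      (≤-<-trans (bound τ) (2*<s i))
      (trans e (trans (sym (combine-injectiveˡ c l c′ l′ eq)) (sym (mod-toℕ c))))
    where
    bound : ∀ τ → 2 * toℕ i + 1 + ⟦ τ ⟧ ≤ 2 * suc (toℕ i)
    bound τ = subst (2 * toℕ i + 1 + ⟦ τ ⟧ ≤_) (ring (toℕ i)) (+-monoʳ-≤ (2 * toℕ i + 1) (b τ))
      where
      b : ∀ τ → ⟦ τ ⟧ ≤ 1
      b true  = s≤s z≤n
      b false = z≤n
      ring : ∀ i → 2 * i + 1 + 1 ≡ 2 * suc i
      ring = solve-∀
  Link-≢ τ (inj₂ (i , j)) {c} {l} {c′} {l′} (mkLink _ e) eq =
    mod-≢ (toℕ l) z<s (f₂<q j) (trans e (trans (sym (combine-injectiveʳ c l c′ l′ eq)) (sym (mod-toℕ l))))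

  private
    advance : ∀ {M} .{{_ : NonZero M}} (c c′ : Fin M) d → toℕ c + d ≡ toℕ c′ → (toℕ c + d) mod M ≡ c′
    advance c c′ d eq = trans (cong (_mod _) eq) (mod-toℕ c′)

    wrap : ∀ {M} .{{_ : NonZero M}} (c c′ : Fin M) d → toℕ c + d ≡ toℕ c′ + M → (toℕ c + d) mod M ≡ c′
    wrap {M} c c′ d eq = trans (mod-cong 0 1 (trans (+-identityʳ _) (trans eq (cong (toℕ c′ +_) (sym (+-identityʳ M)))))) (mod-toℕ c′)

    same : (l : Fin q) → (toℕ l + 0) mod q ≡ l
    same l = advance l l 0 (+-identityʳ (toℕ l))

  -- As `s` is odd, exactly one of `d` and `s - d` has the parity of the voltages of type `τ`, odd
  -- for `false` and even for `true`; this decides the direction.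
  link-row : ∀ τ (l : Fin q) (c c′ : Fin s) → toℕ c < toℕ c′ →
             ∃ λ f → Link τ f c l c′ l ⊎ Link τ f c′ l c l
  link-row τ l c c′ c<c′ = go τ (even⊎odd d)
    where
    d = toℕ c′ ∸ toℕ c
    c+d : toℕ c + d ≡ toℕ c′
    c+d = m+[n∸m]≡n (<⇒≤ c<c′)
    d<s : d < s
    d<s = ≤-<-trans (m∸n≤m (toℕ c′) (toℕ c)) (toℕ<n c′)
    0<d : 0 < d
    0<d = m<n⇒0<n∸m c<c′
    forward : ∀ {k} (k<h : k < h) τ → 2 * k + 1 + ⟦ τ ⟧ ≡ d → Link τ (inj₁ (fromℕ< k<h)) c l c′ l
    forward k<h τ eq = mkLink (advance c c′ _ (trans (cong (λ j → toℕ c + (2 * j + 1 + ⟦ τ ⟧)) (toℕ-fromℕ< k<h)) (trans (cong (toℕ c +_) eq) c+d))) (same l)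
    backward : ∀ {k} (k<h : k < h) τ → d + (2 * k + 1 + ⟦ τ ⟧) ≡ s → Link τ (inj₁ (fromℕ< k<h)) c′ l c l
    backward {k} k<h τ eq = mkLink (wrap c′ c _ (trans (cong (λ j → toℕ c′ + (2 * j + 1 + ⟦ τ ⟧)) (toℕ-fromℕ< k<h))
      (trans (cong (_+ (2 * k + 1 + ⟦ τ ⟧)) (sym c+d)) (trans (+-assoc (toℕ c) d _) (cong (toℕ c +_) eq))))) (same l)
    even : ∀ k → d ≡ 2 * k → ∃ λ j → k ≡ suc j × j < h
    even zero    eq = contradiction (sym eq) (<⇒≢ 0<d)
    even (suc j) eq = j , refl , *-cancelˡ-≤ 2 (≤-pred (subst (_< s) eq d<s))
    odd : ∀ k → d ≡ suc (2 * k) → k < h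
    odd k eq = *-cancelˡ-< 2 k h (≤-pred (subst (_< s) eq d<s))
    ring-oe : ∀ a b → 2 * suc a + (2 * b + 1 + 0) ≡ suc (2 * (suc a + b))
    ring-oe = solve-∀
    ring-oo : ∀ a b → suc (2 * a) + (2 * b + 1 + 1) ≡ suc (2 * (suc a + b))
    ring-oo = solve-∀
    complement : ∀ {k} → k < h → ∃ λ j → j < h × suc k + j ≡ h
    complement {k} k<h = h ∸ suc k , ∸-monoʳ-< {h} z<s k<h , m+[n∸m]≡n k<h
    go : ∀ τ → (∃ λ k → d ≡ 2 * k) ⊎ (∃ λ k → d ≡ suc (2 * k)) → ∃ λ f → Link τ f c l c′ l ⊎ Link τ f c′ l c l
    go false (inj₂ (k , eq)) = _ , inj₁ (forward (odd k eq) false (trans (+-identityʳ _) (trans (+-comm (2 * k) 1) (sym eq))))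
    go true (inj₂ (k , eq)) with complement (odd k eq)
    ... | j , j<h , e = _ , inj₂ (backward j<h true (trans (cong (_+ (2 * j + 1 + 1)) eq) (trans (ring-oo k j) (cong (λ z → suc (2 * z)) e))))
    go false (inj₁ (k , eq)) with even k eq
    ... | k′ , refl , k<h with complement k<h
    ... | j , j<h , e = _ , inj₂ (backward j<h false (trans (cong (_+ (2 * j + 1 + 0)) eq) (trans (ring-oe k′ j) (cong (λ z → suc (2 * z)) e))))
    go true (inj₁ (k , eq)) with even k eq
    ... | k′ , refl , k<h = _ , inj₁ (forward k<h true (trans (r k′) (sym eq)))
      where
      r : ∀ k → 2 * k + 1 + 1 ≡ 2 * suc k
      r = solve-∀

  -- The difference of the second coordinates is at most `m` in exactly one direction; the first
  -- coordinate of the voltage is then free and is solved for.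
  link-column : ∀ τ (c c′ : Fin s) (l l′ : Fin q) → toℕ l < toℕ l′ →
                ∃ λ f → Link τ f c l c′ l′ ⊎ Link τ f c′ l′ c l
  link-column τ c c′ l l′ l<l′ with (toℕ l′ ∸ toℕ l) in eq
  ... | zero = contradiction (sym eq) (<⇒≢ (m<n⇒0<n∸m l<l′))
  ... | suc d with d <? m
  ... | yes d<m with mod-subtract (toℕ c + ⟦ τ ⟧) c′
  ... | z , z<s′ , e = inj₂ (fromℕ< z<s′ , fromℕ< d<m) , inj₁ (mkLink
        (trans (cong (_mod s) (trans (cong (λ w → toℕ c + (w + ⟦ τ ⟧)) (toℕ-fromℕ< z<s′)) (ring (toℕ c) z ⟦ τ ⟧))) e)
        (advance l l′ _ (trans (cong (λ w → toℕ l + suc w) (toℕ-fromℕ< d<m)) (trans (cong (toℕ l +_) (sym eq)) (m+[n∸m]≡n (<⇒≤ l<l′))))))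
    where
    ring : ∀ c z t → c + (z + t) ≡ z + (c + t)
    ring = solve-∀
  link-column τ c c′ l l′ l<l′ | suc d | no d≮m with mod-subtract (toℕ c′ + ⟦ τ ⟧) c
  ... | z , z<s′ , e = inj₂ (fromℕ< z<s′ , fromℕ< d′<m) , inj₂ (mkLink
        (trans (cong (_mod s) (trans (cong (λ w → toℕ c′ + (w + ⟦ τ ⟧)) (toℕ-fromℕ< z<s′)) (ring (toℕ c′) z ⟦ τ ⟧))) e)
        (wrap l′ l _ (trans (cong (λ w → toℕ l′ + suc w) (toℕ-fromℕ< d′<m)) l′+)))
    where
    ring : ∀ c z t → c + (z + t) ≡ z + (c + t)
    ring = solve-∀
    l+d : toℕ l + suc d ≡ toℕ l′
    l+d = trans (cong (toℕ l +_) (sym eq)) (m+[n∸m]≡n (<⇒≤ l<l′))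
    d<2m : d < 2 * m
    d<2m = ≤-pred (≤-trans (s≤s (m≤n+m (suc d) (toℕ l))) (≤-trans (s≤s (≤-reflexive l+d)) (toℕ<n l′)))
    -- `suc d′` is `q - suc d`, the difference in the opposite direction.
    d′ = 2 * m ∸ suc d
    d′<m : d′ < m
    d′<m = ≤-trans (s≤s (∸-monoʳ-≤ (2 * m) (s≤s (≮⇒≥ d≮m)))) (≤-reflexive (lem m (≤-trans (s≤s z≤n) (m<2m d<2m))))
      where
      m<2m : ∀ {d m} → d < 2 * m → 1 ≤ m
      m<2m {m = suc m} _ = s≤s z≤n
      lem : ∀ m → 1 ≤ m → suc (2 * m ∸ suc m) ≡ m
      lem (suc m) _ = cong suc (trans (cong (_∸ suc m) (r m)) (m+n∸m≡n (suc m) m))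
        where
        r : ∀ m → m + (suc m + 0) ≡ suc m + m
        r = solve-∀
    l′+ : toℕ l′ + suc d′ ≡ toℕ l + q
    l′+ = begin
      toℕ l′ + suc d′             ≡⟨ cong (_+ suc d′) (sym l+d) ⟩
      toℕ l + suc d + suc d′      ≡⟨ r (toℕ l) (suc d) d′ ⟩
      toℕ l + suc (suc d + d′)    ≡⟨ cong (λ w → toℕ l + suc w) (m+[n∸m]≡n d<2m) ⟩
      toℕ l + suc (2 * m)         ∎
      where
      open ≡-Reasoning
      r : ∀ l d e → l + d + suc e ≡ l + suc (d + e)
      r = solve-∀

  link : ∀ τ (c : Fin s) (l : Fin q) c′ l′ → combine c l ≢ combine c′ l′ →
         ∃ λ f → Link τ f c l c′ l′ ⊎ Link τ f c′ l′ c l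
  link τ c l c′ l′ neq with <-cmp (toℕ l) (toℕ l′)
  ... | tri< p _ _ = link-column τ c c′ l l′ p
  ... | tri> _ _ p with link-column τ c′ c l′ l p
  ...   | f , inj₁ e = f , inj₂ e
  ...   | f , inj₂ e = f , inj₁ e
  link τ c l c′ l′ neq | tri≈ _ p _ with toℕ-injective p
  ... | refl with <-cmp (toℕ c) (toℕ c′)
  ... | tri< p′ _ _ = link-row τ l c c′ p′
  ... | tri≈ _ p′ _ = contradiction (cong (λ x → combine x l) (toℕ-injective p′)) neq
  ... | tri> _ _ p′ with link-row τ l c′ c p′
  ...   | f , inj₁ e = f , inj₂ e
  ...   | f , inj₂ e = f , inj₁ e

  V : Set
  V = Vtx (suc u) (s * q)

  module _ (o : Fin (suc u)) (f : Colour) (κ : Fin X) (l : Fin q) where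

    -- The b-vertex uses `level (suc n)` because it already includes the step made on aₙbₙ. The way
    -- back to the next a-vertex removes the voltage `f`, so the second coordinate is constant on
    -- the a-vertices.
    liftA liftB : ℕ → V
    liftA n = A o κ n , combine (level n mod s) l
    liftB n = B o κ n , combine ((level (suc n) + f₁ f) mod s) ((toℕ l + f₂ f) mod q)

    liftedCycle : List V
    liftedCycle = zigzag liftA liftB (s * L)

  shiftA : ∀ o κ i k → A o κ (i + k * L) ≡ A o κ i
  shiftA o κ i zero    = cong (A o κ) (+-identityʳ i)
  shiftA o κ i (suc k) = trans (cong (A o κ) (r i L (k * L))) (trans (A-periodic o κ (i + k * L)) (shiftA o κ i k))
    where
    r : ∀ i L z → i + (L + z) ≡ i + z + L
    r = solve-∀

  shiftB : ∀ o κ i k → B o κ (i + k * L) ≡ B o κ i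
  shiftB o κ i zero    = cong (B o κ) (+-identityʳ i)
  shiftB o κ i (suc k) = trans (cong (B o κ) (r i L (k * L))) (trans (B-periodic o κ (i + k * L)) (shiftB o κ i k))
    where
    r : ∀ i L z → i + (L + z) ≡ i + z + L
    r = solve-∀

  liftA-shift : ∀ o f κ l i k {c} → (2 * k + level i) mod s ≡ c → liftA o f κ l (i + k * L) ≡ (A o κ i , combine c l)
  liftA-shift o f κ l i k e = cong₂ _,_ (shiftA o κ i k) (cong (λ c → combine c l) (trans (cong (_mod s) (level-shift i k)) e))

  liftB-shift : ∀ o f κ l i k {c l′} → (2 * k + (level (suc i) + f₁ f)) mod s ≡ c → (toℕ l + f₂ f) mod q ≡ l′ →
    liftB o f κ l (i + k * L) ≡ (B o κ i , combine c l′)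
  liftB-shift o f κ l i k e e′ = cong₂ _,_ (shiftB o κ i k) (cong₂ combine
    (trans (cong (_mod s) (trans (cong (_+ f₁ f) (level-shift (suc i) k)) (+-assoc (2 * k) _ _))) e) e′)

  -- After `s` rounds the level has risen by `2 * s`, which is 0 modulo `s`.
  closed : ∀ o f κ l → liftA o f κ l (s * L) ≡ liftA o f κ l 0
  closed o f κ l = liftA-shift o f κ l 0 s (mod-cong {a = 2 * s + level 0} {b = level 0} 0 2 (r s (level 0)))
    where
    r : ∀ s z → 2 * s + z + 0 ≡ z + 2 * s
    r = solve-∀

  cycleEdges-lifted : ∀ o f κ l → cycleEdges (liftedCycle o f κ l) ≡ openEdges (liftA o f κ l) (liftB o f κ l) (s * L)
  cycleEdges-lifted o f κ l = cycleEdges-zigzag (liftA o f κ l) (liftB o f κ l) (s * L) (closed o f κ l)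

  lifted-adjacent : ∀ o f κ l → AdjacentSteps (liftedCycle o f κ l)
  lifted-adjacent o f κ l = subst (All (λ e → Adj (proj₁ e) (proj₂ e))) (sym (cycleEdges-lifted o f κ l))
    (openEdges-All {P = λ e → Adj (proj₁ e) (proj₂ e)} (liftA o f κ l) (liftB o f κ l) (s * L)
      (λ i → A≢B o κ i , Link-≢ (proj₁ (step-any 1<L i)) f {level i mod s} {l} (mkLink
        (trans (mod-+′ (level i) (f₁ f + ⟦ proj₁ (step-any 1<L i) ⟧))
          (cong (_mod s) (trans (r (level i) (f₁ f) _) (cong (_+ f₁ f) (sym (proj₂ (step-any 1<L i))))))) refl))
      -- This edge has type `false` and is traversed from its b-end, hence the reversal by `sym`.
      (λ i → B≢A o κ i , Link-≢ false f {level (suc i) mod s} {l} (mkLink (trans (mod-+′ (level (suc i)) (f₁ f + 0)) (cong (λ z → (level (suc i) + z) mod s) (+-identityʳ (f₁ f)))) refl) ∘ sym))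
    where
    mod-+′ : ∀ a d → (toℕ (a mod s) + d) mod s ≡ (a + d) mod s
    mod-+′ a d = mod-+ {a = toℕ (a mod s)} {b = a} d (mod-toℕ (a mod s))
    r : ∀ a b c → a + (b + c) ≡ a + c + b
    r = solve-∀

  indices : List (Fin X × Fin q)
  indices = cartesianProduct (allFin X) (allFin q)

  ∈-indices : ∀ κ l → (κ , l) ∈ indices
  ∈-indices κ l = ∈-cartesianProduct⁺ (∈-allFin κ) (∈-allFin l)

  length-indices : length indices ≡ X * q
  length-indices = trans (length-× (allFin X) (allFin q)) (cong₂ _*_ (length-allFin X) (length-allFin q))

  liftedCycles : Fin (suc u) → Colour → List (List V)
  liftedCycles o f = map (λ (κ , l) → liftedCycle o f κ l) indices

  n<sL : ∀ {i k} → i < L → k < s → i + k * L < s * L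
  n<sL {i} {k} i<L k<s = <-≤-trans (+-monoˡ-< (k * L) i<L) (*-monoˡ-≤ L k<s)

  -- Each round meets a given base vertex two levels higher, and 2 is a unit modulo `s`, so all
  -- levels occur. For a b-vertex the lift is the one indexed by its second coordinate minus `f₂ f`.
  vertex-covered : ∀ o f v → proj₁ v ≢ o → v ∈ concat (liftedCycles o f)
  vertex-covered o f (v , γ) v≢o with covers o v v≢o | combine-surjective {s} {q} γ
  ... | κ , i , i<L , inj₁ refl | c , l , refl with mod-halve {h} (level i) c
  ... | k , k<s , e = ∈-concatMap (λ (κ , l) → liftedCycle o f κ l) (∈-indices κ l)
    (subst (_∈ liftedCycle o f κ l) (liftA-shift o f κ l i k e) (zigzag-A (liftA o f κ l) (liftB o f κ l) (n<sL i<L k<s)))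
  vertex-covered o f (v , γ) v≢o | κ , i , i<L , inj₂ refl | c , l , refl
    with mod-halve {h} (level (suc i) + f₁ f) c | mod-subtract {2 * m} (f₂ f) l
  ... | k , k<s , e | z , z<q , e′ = ∈-concatMap (λ (κ , l) → liftedCycle o f κ l) (∈-indices κ l₀)
    (subst (_∈ liftedCycle o f κ l₀)
      (liftB-shift o f κ l₀ i k e (trans (cong (λ w → (w + f₂ f) mod q) (toℕ-fromℕ< z<q)) e′))
      (zigzag-B (liftA o f κ l₀) (liftB o f κ l₀) (n<sL i<L k<s)))
    where l₀ = fromℕ< z<q

  k : ℕ
  k = s * L * 2

  3≤k : 3 ≤ k
  3≤k = ≤-trans (s≤s (s≤s (s≤s z≤n))) (*-monoˡ-≤ 2 (≤-trans 1<L (m≤m+n L _)))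

  lengths : ∀ o f → All (λ c → length c ≡ k) (liftedCycles o f)
  lengths o f = Allₚ.map⁺ (All.universal (λ (κ , l) → length-zigzag (liftA o f κ l) (liftB o f κ l) (s * L)) indices)

  factor : Fin (suc u) × Colour → PartialFactor k (suc u) (s * q)
  factor (o , f) = mkFactor o 3≤k (liftedCycles o f) (lengths o f)
    (Allₚ.map⁺ (All.universal (λ (κ , l) → lifted-adjacent o f κ l) indices))
    (trans (cong (_* k) (trans (length-map _ indices) length-indices)) (ring X q s L))
    (vertex-covered o f)
    where
    ring : ∀ X q s L → X * q * (s * L * 2) ≡ X * (2 * L) * (s * q)
    ring = solve-∀

  factorIndices : List (Fin (suc u) × Colour)
  factorIndices = cartesianProduct (allFin (suc u)) colours

  factorList : List (PartialFactor k (suc u) (s * q))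
  factorList = map factor factorIndices

  factorEdges-length : ∀ of → length (factorEdges (factor of)) ≡ X * q * k
  factorEdges-length (o , f) = trans
    (length-concat k (map cycleEdges (liftedCycles o f)) (Allₚ.map⁺ (Allₚ.map⁺ (All.universal
      (λ (κ , l) → trans (cong length (cycleEdges-lifted o f κ l)) (length-openEdges (liftA o f κ l) (liftB o f κ l) (s * L))) indices))))
    (cong (_* k) (trans (length-map cycleEdges (liftedCycles o f)) (trans (length-map _ indices) length-indices)))

  -- There are `suc u` holes and `h + s * m` colours, half of `s * q - 1`. The term
  -- `2 * m + 2 * h * q` is that predecessor in the form to which the type in `mkARCS` reduces.
  edges-length : length (concatMap factorEdges factorList) * 2 ≡ (suc u * u) * (s * q * (2 * m + 2 * h * q))
  edges-length = trans (cong (_* 2) (trans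
      (length-concat (X * q * k) (map factorEdges factorList) (Allₚ.map⁺ (Allₚ.map⁺ (All.universal factorEdges-length factorIndices))))
      (cong (_* (X * q * k)) (trans (length-map factorEdges factorList) (trans (length-map factor factorIndices)
        (trans (length-× (allFin (suc u)) colours) (cong₂ _*_ (length-allFin (suc u)) length-colours)))))))
    (ring u X L h m)
    where
    ring : ∀ u X L h m → suc u * (h + suc (2 * h) * m) * (X * suc (2 * m) * (suc (2 * h) * L * 2)) * 2
         ≡ (suc u * (X * (2 * L))) * (suc (2 * h) * suc (2 * m) * (2 * m + 2 * h * suc (2 * m)))
    ring = solve-∀

  ∈-edges : ∀ {o f κ l e} → e ∈ openEdges (liftA o f κ l) (liftB o f κ l) (s * L) → e ∈ concatMap factorEdges factorList
  ∈-edges {o} {f} {κ} {l} e∈ =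
    ∈-concatMap factorEdges (∈-map⁺ factor (∈-cartesianProduct⁺ (∈-allFin o) (∈-colours f)))
      (∈-concatMap cycleEdges (∈-map⁺ (λ (κ , l) → liftedCycle o f κ l) (∈-indices κ l))
        (subst (_ ∈_) (sym (cycleEdges-lifted o f κ l)) e∈))

  Covered : V → V → Set
  Covered x y = (x , y) ∈ concatMap factorEdges factorList ⊎ (y , x) ∈ concatMap factorEdges factorList

  -- Halving finds the round in which the a-end is on level `c`; the voltage then puts the b-end
  -- where `Link` says.
  edge-covered : ∀ {v w τ f c l c′ l′} → Joins walk v w τ → Link τ f c l c′ l′ →
                 Covered (v , combine c l) (w , combine c′ l′)
  edge-covered {τ = τ} {f} {c} {l} (o , κ , i , i<L , inj₁ (refl , refl , st)) (mkLink e₁ e₂) with mod-halve {h} (level i) c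
  ... | k , k<s , e = inj₁ (∈-edges (subst (_∈ openEdges (liftA o f κ l) (liftB o f κ l) (s * L))
      (cong₂ _,_ (liftA-shift o f κ l i k e) (liftB-shift o f κ l i k (trans top e₁) e₂))
      (openEdges-AB (liftA o f κ l) (liftB o f κ l) (n<sL i<L k<s))))
    where
    r : ∀ a b f t → a + (b + t + f) ≡ a + b + (f + t)
    r = solve-∀
    top : (2 * k + (level (suc i) + f₁ f)) mod s ≡ (toℕ c + (f₁ f + ⟦ τ ⟧)) mod s
    top = trans (cong (_mod s) (trans (cong (λ z → 2 * k + (z + f₁ f)) st) (r (2 * k) (level i) (f₁ f) ⟦ τ ⟧)))
                (mod-+ {a = 2 * k + level i} {b = toℕ c} (f₁ f + ⟦ τ ⟧) (trans e (sym (mod-toℕ c))))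
  edge-covered {f = f} {c} {l} (o , κ , i , i<L , inj₂ (refl , refl , refl)) (mkLink e₁ e₂) with mod-halve {h} (level (suc i)) c
  ... | k , k<s , e = inj₂ (∈-edges (subst (_∈ openEdges (liftA o f κ l) (liftB o f κ l) (s * L))
      (cong₂ _,_ (liftB-shift o f κ l i k (trans top e₁) e₂) (liftA-shift o f κ l (suc i) k e))
      (openEdges-BA (liftA o f κ l) (liftB o f κ l) (n<sL i<L k<s))))
    where
    r : ∀ a b f → a + (b + f) ≡ a + b + (f + 0)
    r = solve-∀
    top : (2 * k + (level (suc i) + f₁ f)) mod s ≡ (toℕ c + (f₁ f + 0)) mod s
    top = trans (cong (_mod s) (r (2 * k) (level (suc i)) (f₁ f)))
                (mod-+ {a = 2 * k + level (suc i)} {b = toℕ c} (f₁ f + 0) (trans e (sym (mod-toℕ c))))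

  -- Only after `τ` is fixed does `link` decide which end is the a-end. Hence the demand that both
  -- orders of a pair of points have the same type.
  all-covered : ∀ x y → Adj x y → Covered x y
  all-covered (v , γ) (w , γ′) (v≢w , γ≢γ′)
    with combine-surjective {s} {q} γ | combine-surjective {s} {q} γ′ | joins v w v≢w
  ... | c , l , refl | c′ , l′ , refl | τ , vw , wv with link τ c l c′ l′ γ≢γ′
  ...   | f , inj₁ e = edge-covered vw e
  ...   | f , inj₂ e with edge-covered wv e
  ...     | inj₁ p = inj₂ p
  ...     | inj₂ p = inj₁ p

  arcs-lifted : ARCS k (suc u) (s * q)
  arcs-lifted = mkARCS factorList edges-length all-covered

-- Near-derangements of the groups and their 3-colourings

-- By finiteness `σ-onto` makes `σ i` a permutation of the groups other than `i`. By `σ-link` every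
-- ordered pair of groups is an arc of some `σ i`.
record ArcSystem (X : ℕ) : Set where
  field
    σ      : Fin X → Fin X → Fin X
    colour : Fin X → Fin X → Fin 3
    σ-≢    : ∀ i j → i ≢ j → σ i j ≢ j
    σ-onto : ∀ i j → i ≢ j → ∃ λ j′ → i ≢ j′ × σ i j′ ≡ j
    σ-link : ∀ j j′ → j ≢ j′ → ∃ λ i → i ≢ j × σ i j ≡ j′
    proper : ∀ i j → i ≢ j → colour i j ≢ colour i (σ i j)

-- Colours the two points of a 2-cycle by which is the smaller.
byOrder : ∀ {m n} → Dec (m < n) → Fin 3
byOrder (yes _) = zero
byOrder (no _)  = suc zero

byOrder-swap : ∀ {m n} (p : Dec (m < n)) (q : Dec (n < m)) → m ≢ n → byOrder p ≢ byOrder q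
byOrder-swap (yes p) (yes q) _   _ = <-asym p q
byOrder-swap (no p)  (no q)  m≢n _ = q (≤∧≢⇒< (≮⇒≥ p) (m≢n ∘ sym))

byOrder-≢2 : ∀ {m n} (p : Dec (m < n)) → byOrder p ≢ suc (suc zero)
byOrder-≢2 (yes _) ()
byOrder-≢2 (no _)  ()

module Reflection (z : ℕ) where

  M : ℕ
  M = suc (2 * z)

  -- j ↦ 2i − j, as 2z ≡ −1.
  ρ : Fin M → Fin M → Fin M
  ρ i j = (2 * toℕ i + 2 * z * toℕ j) mod M

  -- The equation j + j′ = 2i determines j′; being symmetric in j and j′, it also yields the
  -- involution law.
  ρ-unique : ∀ i j j′ → (toℕ j + toℕ j′) mod M ≡ (2 * toℕ i) mod M → ρ i j ≡ j′
  ρ-unique i j j′ eq = trans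
    (mod-+ {a = 2 * toℕ i} {b = toℕ j + toℕ j′} (2 * z * toℕ j) (sym eq))
    (trans (mod-cong {a = toℕ j + toℕ j′ + 2 * z * toℕ j} {b = toℕ j′} 0 (toℕ j) (ring (toℕ j) (toℕ j′) z)) (mod-toℕ j′))
    where
    ring : ∀ a b z → a + b + 2 * z * a + 0 ≡ b + a * suc (2 * z)
    ring = solve-∀

  ρ-sum : ∀ i j → (toℕ j + toℕ (ρ i j)) mod M ≡ (2 * toℕ i) mod M
  ρ-sum i j = begin
    (toℕ j + toℕ (ρ i j)) mod M                  ≡⟨ cong (_mod M) (+-comm (toℕ j) _) ⟩
    (toℕ (ρ i j) + toℕ j) mod M                  ≡⟨ mod-+ {a = toℕ (ρ i j)} {b = 2 * toℕ i + 2 * z * toℕ j} (toℕ j) (mod-toℕ (ρ i j)) ⟩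
    (2 * toℕ i + 2 * z * toℕ j + toℕ j) mod M    ≡⟨ mod-cong 0 (toℕ j) (ring (toℕ i) z (toℕ j)) ⟩
    (2 * toℕ i) mod M                            ∎
    where
    open ≡-Reasoning
    ring : ∀ i z j → 2 * i + 2 * z * j + j + 0 ≡ 2 * i + j * suc (2 * z)
    ring = solve-∀

  ρ-involutive : ∀ i j → ρ i (ρ i j) ≡ j
  ρ-involutive i j = ρ-unique i (ρ i j) j (trans (cong (_mod M) (+-comm (toℕ (ρ i j)) (toℕ j))) (ρ-sum i j))

  ρ-centre : ∀ i → ρ i i ≡ i
  ρ-centre i = ρ-unique i i i (cong (λ w → (toℕ i + w) mod M) (sym (+-identityʳ (toℕ i))))

  -- From 2j = 2i follows j = i on multiplying by `suc z`, the inverse of 2 modulo `M`.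
  ρ-fixed : ∀ i j → ρ i j ≡ j → i ≡ j
  ρ-fixed i j eq with mod-cancel {M} {toℕ j + toℕ j} {2 * toℕ i} (trans (cong (λ w → (toℕ j + toℕ w) mod M) (sym eq)) (ρ-sum i j))
  ... | p , q , e = trans (sym (mod-toℕ i)) (trans
      (mod-cong {a = toℕ i} {b = toℕ j} (toℕ i + suc z * q) (toℕ j + suc z * p)
        (trans (ring₁ (toℕ i) z q) (trans (cong (suc z *_) (sym e)) (ring₂ (toℕ j) z p)))) (mod-toℕ j))
    where
    ring₁ : ∀ i z q → i + (i + suc z * q) * suc (2 * z) ≡ suc z * (2 * i + q * suc (2 * z))
    ring₁ = solve-∀
    ring₂ : ∀ j z p → suc z * (j + j + p * suc (2 * z)) ≡ j + (j + suc z * p) * suc (2 * z)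
    ring₂ = solve-∀

  ρ-≢centre : ∀ i j → i ≢ j → i ≢ ρ i j
  ρ-≢centre i j i≢j eq = i≢j (trans (sym (ρ-centre i)) (trans (cong (ρ i) eq) (ρ-involutive i j)))

  midpoint : ∀ j j′ → ∃ λ i → ρ i j ≡ j′
  midpoint j j′ with mod-halve {z} 0 ((toℕ j + toℕ j′) mod M)
  ... | k , k<M , e = fromℕ< k<M , ρ-unique (fromℕ< k<M) j j′ (trans (sym e) (cong (_mod M) (trans (+-identityʳ (2 * k)) (cong (2 *_) (sym (toℕ-fromℕ< k<M))))))

  midpoint-≢ : ∀ i j j′ → ρ i j ≡ j′ → j ≢ j′ → i ≢ j
  midpoint-≢ i .i j′ eq j≢j′ refl = j≢j′ (trans (sym (ρ-centre i)) eq)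

  tint : Fin M → Fin M → Fin 3
  tint i j = byOrder (toℕ j <? toℕ (ρ i j))

  tint-proper : ∀ i j → i ≢ j → tint i j ≢ tint i (ρ i j)
  tint-proper i j i≢j rewrite ρ-involutive i j =
    byOrder-swap (toℕ j <? toℕ (ρ i j)) (toℕ (ρ i j) <? toℕ j) λ eq → i≢j (ρ-fixed i j (toℕ-injective (sym eq)))

-- In ℤ_x with x odd the reflection about `i` fixes only `i`, and the ordered pair (j, j′) belongs
-- to the reflection about its midpoint. All other cycles have length 2, so two colours suffice.
oddSystem : ∀ z → ArcSystem (suc (2 * z))
oddSystem z = record
  { σ      = ρ
  ; colour = tint
  ; σ-≢    = λ i j i≢j eq → i≢j (ρ-fixed i j eq)
  ; σ-onto = λ i j i≢j → ρ i j , ρ-≢centre i j i≢j , ρ-involutive i j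
  ; σ-link = λ j j′ j≢j′ → let i , e = midpoint j j′ in i , midpoint-≢ i j j′ e j≢j′ , e
  ; proper = tint-proper
  }
  where open Reflection z

module Even (z : ℕ) (0<z : 0 < z) where

  open Reflection z

  pattern ∞ = zero

  next top : Fin M → Fin M
  next j = (toℕ j + 1) mod M
  top i  = (toℕ i + z) mod M

  z<M : z < M
  z<M = s≤s (m≤m+n z _)

  top-≢ : ∀ i → top i ≢ i
  top-≢ i eq = mod-≢ (toℕ i) 0<z z<M (trans eq (sym (mod-toℕ i)))

  next-≢ : ∀ j → next j ≢ j
  next-≢ j eq = mod-≢ (toℕ j) z<s (s≤s (≤-trans 0<z (m≤m+n z _))) (trans eq (sym (mod-toℕ j)))

  toℕ-top : ∀ i d → (toℕ (top i) + d) mod M ≡ (toℕ i + z + d) mod M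
  toℕ-top i d = mod-+ {a = toℕ (top i)} {b = toℕ i + z} d (mod-toℕ (top i))

  -- The sum of i + z and its successor is 2i + `M`.
  ρ-top : ∀ i → ρ i (top i) ≡ next (top i)
  ρ-top i = ρ-unique i (top i) (next (top i)) (begin
    (toℕ (top i) + toℕ (next (top i))) mod M ≡⟨ toℕ-top i (toℕ (next (top i))) ⟩
    (toℕ i + z + toℕ (next (top i))) mod M   ≡⟨ cong (_mod M) (+-comm (toℕ i + z) _) ⟩
    (toℕ (next (top i)) + (toℕ i + z)) mod M ≡⟨ mod-+ {a = toℕ (next (top i))} {b = toℕ (top i) + 1} (toℕ i + z) (mod-toℕ (next (top i))) ⟩
    (toℕ (top i) + 1 + (toℕ i + z)) mod M    ≡⟨ mod-+ {a = toℕ (top i) + 1} {b = toℕ i + z + 1} (toℕ i + z) (toℕ-top i 1) ⟩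
    (toℕ i + z + 1 + (toℕ i + z)) mod M      ≡⟨ mod-cong 0 1 (ring (toℕ i) z) ⟩
    (2 * toℕ i) mod M                        ∎)
    where
    open ≡-Reasoning
    ring : ∀ i z → i + z + 1 + (i + z) + 0 ≡ 2 * i + 1 * suc (2 * z)
    ring = solve-∀

  top-onto : ∀ j → ∃ λ i → top i ≡ j
  top-onto j with mod-subtract {2 * z} z j
  ... | k , k<M , e = fromℕ< k<M , trans (cong (λ w → (w + z) mod M) (toℕ-fromℕ< k<M)) e

  next-onto : ∀ j → ∃ λ i → next i ≡ j
  next-onto j with mod-subtract {2 * z} 1 j
  ... | k , k<M , e = fromℕ< k<M , trans (cong (λ w → (w + 1) mod M) (toℕ-fromℕ< k<M)) e

  reflect : ∀ i j → Dec (j ≡ top i) → Fin (suc M)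
  reflect i j (yes _) = ∞
  reflect i j (no _)  = suc (ρ i j)

  -- In the reflection about i the two points i ± z differ by one; inserting ∞ between them frees
  -- the arc i + z → i − z = (i + z) + 1, which is used by σ ∞.
  σ : Fin (suc M) → Fin (suc M) → Fin (suc M)
  σ ∞       ∞       = ∞
  σ ∞       (suc j) = suc (next j)
  σ (suc i) ∞       = suc (next (top i))
  σ (suc i) (suc j) = reflect i j (j ≟ᶠ top i)

  parity : ℕ → Fin 3
  parity zero          = zero
  parity (suc zero)    = suc zero
  parity (suc (suc n)) = parity n

  parity-suc : ∀ n → parity n ≢ parity (suc n)
  parity-suc zero          ()
  parity-suc (suc zero)    ()
  parity-suc (suc (suc n)) = parity-suc n

  parity-≢2 : ∀ n → parity n ≢ suc (suc zero)
  parity-≢2 zero          ()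
  parity-≢2 (suc zero)    ()
  parity-≢2 (suc (suc n)) = parity-≢2 n

  -- `σ ∞` is a single cycle of odd length `M` on the finite points: parities alternate along it and
  -- the last point takes the third colour.
  along : ∀ n → Dec (n ≡ 2 * z) → Fin 3
  along n (yes _) = suc (suc zero)
  along n (no _)  = parity n

  -- For a finite `i` the point `∞` lies on a 3-cycle with `top i` and its successor; these two keep
  -- the colours of the reflection and `∞` takes the third.
  colour : Fin (suc M) → Fin (suc M) → Fin 3
  colour ∞       ∞       = zero
  colour ∞       (suc j) = along (toℕ j) (toℕ j ≟ 2 * z)
  colour (suc i) ∞       = suc (suc zero)
  colour (suc i) (suc j) = tint i j

  along-proper : ∀ j → along (toℕ j) (toℕ j ≟ 2 * z) ≢ along (toℕ (next j)) (toℕ (next j) ≟ 2 * z)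
  along-proper j with toℕ j ≟ 2 * z
  ... | yes e with toℕ (next j) ≟ 2 * z
  ...   | yes e′ = λ _ → next-≢ j (toℕ-injective (trans e′ (sym e)))
  ...   | no _   = parity-≢2 (toℕ (next j)) ∘ sym
  along-proper j | no j≢ with toℕ (next j) ≟ 2 * z
  ...   | yes _ = parity-≢2 (toℕ j)
  ...   | no _  = λ e → parity-suc (toℕ j) (trans e (cong parity toℕ-next))
    where
    -- Only the last point wraps round.
    toℕ-next : toℕ (next j) ≡ suc (toℕ j)
    toℕ-next = trans (toℕ-mod (toℕ j + 1)) (trans (m<n⇒m%n≡m (subst (_< M) (+-comm 1 (toℕ j)) (s≤s (≤∧≢⇒< (≤-pred (toℕ<n j)) j≢)))) (+-comm (toℕ j) 1))

  system : ArcSystem (suc M)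
  system = record
    { σ = σ ; colour = colour ; σ-≢ = neq ; σ-onto = onto ; σ-link = linked ; proper = prop }
    where
    neq : ∀ i j → i ≢ j → σ i j ≢ j
    neq ∞       ∞       i≢j _  = i≢j refl
    neq ∞       (suc j) i≢j eq = next-≢ j (sucᶠ-injective eq)
    neq (suc i) ∞       i≢j ()
    neq (suc i) (suc j) i≢j eq with j ≟ᶠ top i
    neq (suc i) (suc j) i≢j () | yes _
    ... | no _ = i≢j (cong suc (ρ-fixed i j (sucᶠ-injective eq)))
    onto : ∀ i j → i ≢ j → ∃ λ j′ → i ≢ j′ × σ i j′ ≡ j
    onto ∞       ∞       i≢j = contradiction refl i≢j
    onto ∞       (suc j) i≢j with next-onto j
    ... | j′ , e = suc j′ , (λ ()) , cong suc e
    onto (suc i) ∞       i≢j = suc (top i) , (λ e → top-≢ i (sym (sucᶠ-injective e))) , lem (top i ≟ᶠ top i)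
      where
      lem : ∀ d → reflect i (top i) d ≡ ∞
      lem (yes _) = refl
      lem (no n)  = contradiction refl n
    onto (suc i) (suc j) i≢j with j ≟ᶠ next (top i)
    ... | yes refl = ∞ , (λ ()) , refl
    ... | no j≢ = suc (ρ i j) , (λ e → ρ-≢centre i j (i≢j ∘ cong suc) (sucᶠ-injective e)) , lem (ρ i j ≟ᶠ top i)
      where
      lem : ∀ d → reflect i (ρ i j) d ≡ suc j
      lem (yes e) = contradiction (trans (sym (ρ-involutive i j)) (trans (cong (ρ i) e) (ρ-top i))) j≢
      lem (no _)  = cong suc (ρ-involutive i j)
    linked : ∀ j j′ → j ≢ j′ → ∃ λ i → i ≢ j × σ i j ≡ j′
    linked ∞       ∞        j≢j′ = contradiction refl j≢j′
    linked ∞       (suc j′) j≢j′ with next-onto j′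
    ... | t , e with top-onto t
    ... | i , e′ = suc i , (λ ()) , cong suc (trans (cong next e′) e)
    linked (suc j) ∞        j≢j′ with top-onto j
    ... | i , e = suc i , (λ { refl → top-≢ i e }) , lem (j ≟ᶠ top i)
      where
      lem : ∀ d → reflect i j d ≡ ∞
      lem (yes _) = refl
      lem (no n)  = contradiction (sym e) n
    linked (suc j) (suc j′) j≢j′ with midpoint j j′
    ... | i , e with j ≟ᶠ top i in d
    -- The reflection about the midpoint has lost this arc to `∞`; it joins `j` to its successor and
    -- so belongs to `σ ∞`.
    ...   | yes j≡ = ∞ , (λ ()) , cong suc (trans (cong next j≡) (trans (sym (ρ-top i)) (trans (cong (ρ i) (sym j≡)) e)))
    ...   | no _   = suc i , (λ i≡j → midpoint-≢ i j j′ e (j≢j′ ∘ cong suc) (sucᶠ-injective i≡j)) , trans (cong (reflect i j) d) (cong suc e)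
    prop : ∀ i j → i ≢ j → colour i j ≢ colour i (σ i j)
    prop ∞       ∞       i≢j = contradiction refl i≢j
    prop ∞       (suc j) i≢j = along-proper j
    prop (suc i) ∞       i≢j = byOrder-≢2 (toℕ (next (top i)) <? toℕ (ρ i (next (top i)))) ∘ sym
    prop (suc i) (suc j) i≢j with j ≟ᶠ top i
    ... | yes _ = byOrder-≢2 (toℕ j <? toℕ (ρ i j))
    ... | no _  = tint-proper i j (i≢j ∘ cong suc)

arcSystem : ∀ x → 0 < x → x ≢ 2 → ArcSystem x
arcSystem x 0<x x≢2 with even⊎odd x
... | inj₂ (z , refl)             = oddSystem z
... | inj₁ (zero , refl)          = contradiction 0<x (λ ())
... | inj₁ (suc zero , refl)      = contradiction refl x≢2
... | inj₁ (suc (suc z) , refl)   = subst ArcSystem (sym (*-suc 2 (suc z))) (Even.system (suc z) z<s)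

difference : ∀ {m n} → m ≤ n → ∃ λ d → m + d ≡ n
difference {m} {n} m≤n = n ∸ m , m+[n∸m]≡n m≤n

-- Rosa's α-labelling of the cycle of length 4y

module Rosa (y′ : ℕ) where

  y L N : ℕ
  y = suc y′
  L = 2 * y
  N = suc (2 * L)

  open Level L

  y<L : y < L
  y<L = m<m+n y z<s

  1<L : 1 < L
  1<L = ≤-<-trans (s≤s z≤n) y<L

  -- The a-vertices carry the labels 0, ..., L-1. The b-labels descend from 2L and skip 2L-y = 3y
  -- halfway, which makes the differences along the cycle run through 1, ..., 2L.
  β : ℕ → ℕ
  β i with i <? y
  ... | yes _ = 2 * L ∸ i
  ... | no _  = 2 * L ∸ suc i

  β-low : ∀ {i} → i < y → β i + i ≡ 2 * L
  β-low {i} i<y with i <? y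
  ... | yes _ = m∸n+n≡m (<⇒≤ (<-trans i<y (<-≤-trans y<L (m≤m+n L _))))
  ... | no n  = contradiction i<y n

  β-high : ∀ {i} → y ≤ i → i < L → β i + suc i ≡ 2 * L
  β-high {i} y≤i i<L with i <? y
  ... | yes p = contradiction p (≤⇒≯ y≤i)
  ... | no _  = m∸n+n≡m (≤-trans i<L (m≤m+n L _))

  β-low-≡ : ∀ {i b} → i < y → b + i ≡ 2 * L → β i ≡ b
  β-low-≡ {i} i<y eq = +-cancelʳ-≡ i _ _ (trans (β-low i<y) (sym eq))

  β-high-≡ : ∀ {i b} → y ≤ i → i < L → b + suc i ≡ 2 * L → β i ≡ b
  β-high-≡ {i} y≤i i<L eq = +-cancelʳ-≡ (suc i) _ _ (trans (β-high y≤i i<L) (sym eq))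

  β-≥ : ∀ {i} → i < L → L ≤ β i
  β-≥ {i} i<L with i <? y
  ... | yes p = ≤-trans (≤-reflexive (sym (m+n∸n≡m L L))) (≤-trans (∸-monoʳ-≤ (L + L) (<⇒≤ i<L)) (≤-reflexive (cong (λ z → L + z ∸ i) (sym (+-identityʳ L)))))
  ... | no _  = ≤-trans (≤-reflexive (sym (m+n∸n≡m L L))) (≤-trans (∸-monoʳ-≤ (L + L) i<L) (≤-reflexive (cong (λ z → L + z ∸ suc i) (sym (+-identityʳ L)))))

  β-≤ : ∀ i → β i ≤ 2 * L
  β-≤ i with i <? y
  ... | yes _ = m∸n≤m (2 * L) i
  ... | no _  = m∸n≤m (2 * L) (suc i)

  next-< : ∀ {i} → suc i < L → suc i % L ≡ suc i
  next-< = m<n⇒m%n≡m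

  -- `d` is the difference of labels on aᵢbᵢ and on bᵢaᵢ₊₁ respectively; the remainder sends the
  -- index after the last to 0.
  Forward Backward : ℕ → ℕ → Set
  Forward i d  = β i ≡ i + d
  Backward i d = β i ≡ suc i % L + d

  backward : ∀ {i d} → suc i < L → β i ≡ suc i + d → Backward i d
  backward {i} {d} i<L eq = trans eq (cong (_+ d) (sym (next-< i<L)))

  forward-first : Forward 0 (2 * L)
  forward-first = β-low-≡ z<s (+-identityʳ (2 * L))

  last : ℕ
  last = y′ + y

  last-suc : suc last ≡ L
  last-suc = cong (y +_) (sym (+-identityʳ y))

  last<L : last < L
  last<L = ≤-reflexive last-suc

  forward-last : Forward last 1
  forward-last = β-high-≡ (m≤n+m y y′) last<L (trans (cong₂ _+_ (trans (+-comm last 1) last-suc) last-suc) (cong (L +_) (sym (+-identityʳ L))))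

  -- Even differences above L and odd ones below L occur on edges aᵢbᵢ, the others on edges bᵢaᵢ₊₁,
  -- with L itself on the closing edge. The bounds leave out 2L and 1, which belong to the two edges
  -- of the second kind.
  interior : ∀ d → 1 < d → d < 2 * L →
             ∃ λ i → i < L × ((Forward i d × Step i false) ⊎ Backward i d)
  interior d 1<d d<2L with even⊎odd d
  interior .(2 * k) 1<d d<2L | inj₁ (k , refl) with <-cmp k y | difference (<⇒≤ (*-cancelˡ-< 2 k L d<2L))
  ... | tri> _ _ y<k | i , k+i = i , <⇒≤ 1+i<L , inj₁ (β-low-≡ i<y (trans (ring i k) (cong (2 *_) k+i)) , step-inner 0<i 1+i<L)
    where
    ring : ∀ i k → i + 2 * k + i ≡ 2 * (k + i)
    ring = solve-∀
    i<y : i < y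
    i<y = +-cancelˡ-< y i y (<-≤-trans (+-monoˡ-< i y<k) (≤-reflexive (trans k+i (cong (y +_) (+-identityʳ y)))))
    1+i<L : suc i < L
    1+i<L = ≤-<-trans i<y y<L
    0<i : 0 < i
    0<i = +-cancelˡ-< k 0 i (subst (_< k + i) (sym (+-identityʳ k)) (subst (k <_) (sym k+i) (*-cancelˡ-< 2 k L d<2L)))
  ... | tri≈ _ refl _ | _ = last , last<L , inj₂ (trans (β-high-≡ {b = L} (m≤n+m y y′) last<L (trans (cong (L +_) last-suc) (cong (L +_) (sym (+-identityʳ L)))))
                              (cong (_+ L) (sym (trans (cong (_% L) last-suc) (n%n≡0 L)))))
  ... | tri< k<y _ _ | zero , k+i = contradiction (trans (sym (+-identityʳ k)) k+i) (<⇒≢ (<-trans k<y y<L))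
  ... | tri< k<y _ _ | suc i , k+i = i , <⇒≤ 1+i<L , inj₂ (backward 1+i<L (β-high-≡ y≤i (<⇒≤ 1+i<L) (trans (ring i k) (cong (2 *_) k+i))))
    where
    ring : ∀ i k → suc i + 2 * k + suc i ≡ 2 * (k + suc i)
    ring = solve-∀
    0<k : 0 < k
    0<k = *-cancelˡ-< 2 0 k (<-trans z<s 1<d)
    1+i<L : suc i < L
    1+i<L = subst (suc i <_) k+i (m<n+m (suc i) 0<k)
    y≤i : y ≤ i
    y≤i = ≤-pred (+-cancelˡ-≤ k (suc y) (suc i) (≤-trans (≤-trans (≤-reflexive (+-suc k y)) (+-monoˡ-≤ y k<y)) (≤-reflexive (sym (trans k+i (cong (y +_) (+-identityʳ y)))))))
  interior .(suc (2 * k)) 1<d d<2L | inj₂ (k , refl) with k <? y | difference {suc k} {L} (*-cancelˡ-< 2 k L (<⇒≤ d<2L))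
  ... | no k≮y | i , k+i = i , <⇒≤ 1+i<L , inj₂ (backward 1+i<L (β-low-≡ i<y (trans (ring i k) (cong (2 *_) k+i))))
    where
    ring : ∀ i k → suc i + suc (2 * k) + i ≡ 2 * (suc k + i)
    ring = solve-∀
    i<y : i < y
    i<y = +-cancelˡ-≤ y (suc i) y (≤-trans (≤-reflexive (+-suc y i)) (≤-trans (+-monoˡ-≤ i (s≤s (≮⇒≥ k≮y))) (≤-reflexive (trans k+i (cong (y +_) (+-identityʳ y))))))
    1+i<L : suc i < L
    1+i<L = ≤-<-trans i<y y<L
  ... | yes k<y | i , k+i = i , <⇒≤ 1+i<L , inj₁ (β-high-≡ y≤i (<⇒≤ 1+i<L) (trans (ring i k) (cong (2 *_) k+i)) , step-inner (<-≤-trans z<s y≤i) 1+i<L)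
    where
    ring : ∀ i k → i + suc (2 * k) + suc i ≡ 2 * (suc k + i)
    ring = solve-∀
    0<k : 0 < k
    0<k = *-cancelˡ-< 2 0 k (≤-pred 1<d)
    1+i<L : suc i < L
    1+i<L = subst (suc i <_) k+i (s≤s (m<n+m i 0<k))
    y≤i : y ≤ i
    y≤i = +-cancelˡ-≤ y y i (≤-trans (≤-reflexive (trans (cong (y +_) (sym (+-identityʳ y))) (sym k+i))) (+-monoˡ-≤ i k<y))

  -- The label missed by the α-labelling is 3y, so the cycle avoiding c is its translate by c − 3y = c + y + 1.
  origin : Fin N → ℕ
  origin c = toℕ c + suc y

  a b : Fin N → ℕ → Fin N
  a c n = (n % L + origin c) mod N
  b c n = (β (n % L) + origin c) mod N

  a-periodic : ∀ c n → a c (n + L) ≡ a c n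
  a-periodic c n = cong (λ r → (r + origin c) mod N) ([m+n]%n≡m%n n L)

  b-periodic : ∀ c n → b c (n + L) ≡ b c n
  b-periodic c n = cong (λ r → (β r + origin c) mod N) ([m+n]%n≡m%n n L)

  distinct : ∀ c {i k} → i < L → k < L → (k + origin c) mod N ≢ (β i + origin c) mod N
  distinct c {i} {k} i<L k<L eq with difference (<⇒≤ (<-≤-trans k<L (β-≥ i<L)))
  ... | zero , e  = contradiction (trans (sym (+-identityʳ k)) e) (<⇒≢ (<-≤-trans k<L (β-≥ i<L)))
  ... | suc d , e = mod-≢ (k + origin c) {suc d} z<s (s≤s (≤-trans (m≤n+m (suc d) k) (≤-trans (≤-reflexive e) (β-≤ i))))
                      (trans (cong (_mod N) (trans (ring k (origin c) (suc d)) (cong (_+ origin c) e))) (sym eq))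
    where
    ring : ∀ k c d → k + c + d ≡ k + d + c
    ring = solve-∀

  a≢b : ∀ c n → a c n ≢ b c n
  a≢b c n = distinct c (m%n<n n L) (m%n<n n L)

  b≢a : ∀ c n → b c n ≢ a c (suc n)
  b≢a c n eq = distinct c {n % L} {suc n % L} (m%n<n n L) (m%n<n (suc n) L) (sym eq)

  a-< : ∀ c {i} → i < L → a c i ≡ (i + origin c) mod N
  a-< c i<L = cong (λ r → (r + origin c) mod N) (m<n⇒m%n≡m i<L)

  b-< : ∀ c {i} → i < L → b c i ≡ (β i + origin c) mod N
  b-< c i<L = cong (λ r → (β r + origin c) mod N) (m<n⇒m%n≡m i<L)

  label-covered : ∀ c p → p ≢ c → ∃ λ i → i < L × (a c i ≡ p ⊎ b c i ≡ p)
  label-covered c p p≢c with mod-subtract {2 * L} (origin c) p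
  ... | z , z<N , e with z <? L
  ... | yes z<L = z , z<L , inj₁ (trans (a-< c z<L) e)
  ... | no z≮L with difference (≤-pred z<N) | <-cmp z (L + y)
  ... | i , z+i | tri> _ _ z>3y = i , i<L , inj₂ (trans (b-< c i<L) (trans (cong (λ w → (w + origin c) mod N) (β-low-≡ i<y z+i)) e))
    where
    i<y : i < y
    i<y = +-cancelˡ-< (L + y) i y (<-≤-trans (+-monoˡ-< i z>3y) (≤-reflexive (trans z+i (ring y))))
      where
      ring : ∀ y → 2 * (2 * y) ≡ 2 * y + y + y
      ring = solve-∀
    i<L : i < L
    i<L = <-trans i<y y<L
  -- As 3y + (y + 1) = `N`, the translate of the missed label is `c` itself.
  ... | i , z+i | tri≈ _ refl _ = contradiction (trans (sym e) (trans (mod-cong 0 1 (ring y (toℕ c))) (mod-toℕ c))) p≢c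
    where
    ring : ∀ y c → 2 * y + y + (c + suc y) + 0 ≡ c + 1 * suc (2 * (2 * y))
    ring = solve-∀
  ... | zero , z+i | tri< z<3y _ _ = contradiction (subst (_< L + y) (trans (sym (+-identityʳ z)) z+i) z<3y)
                                       (≤⇒≯ (+-monoʳ-≤ L (≤-trans (<⇒≤ y<L) (≤-reflexive (sym (+-identityʳ L))))))
  ... | suc i , z+i | tri< z<3y _ _ = i , i<L , inj₂ (trans (b-< c i<L) (trans (cong (λ w → (w + origin c) mod N) (β-high-≡ y≤i i<L z+i)) e))
    where
    i<L : i < L
    i<L = +-cancelˡ-≤ L (suc i) L (≤-trans (+-monoˡ-≤ (suc i) (≮⇒≥ z≮L)) (≤-reflexive (trans z+i (cong (L +_) (+-identityʳ L)))))
    y≤i : y ≤ i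
    y≤i = ≤-pred (+-cancelˡ-< (L + y) y (suc i) (≤-<-trans (≤-reflexive (trans (ring y) (sym z+i))) (+-monoˡ-< (suc i) z<3y)))
      where
      ring : ∀ y → 2 * y + y + y ≡ 2 * (2 * y)
      ring = solve-∀

  LabelJoins : Fin N → Fin N → Bool → Set
  LabelJoins p p′ τ = ∃₂ λ c i → i < L ×
    ((a c i ≡ p × b c i ≡ p′ × Step i τ) ⊎ (a c (suc i) ≡ p × b c i ≡ p′ × τ ≡ false))

  -- The translation is chosen to carry the label `k` to `p`; the difference `d` then carries the
  -- other end to `p′`.
  translate : ∀ {i d p p′} k → β i ≡ k + d → (toℕ p + d) mod N ≡ p′ →
              ∃ λ c → (k + origin c) mod N ≡ p × (β i + origin c) mod N ≡ p′
  translate {i} {d} {p} {p′} k eq e with mod-subtract {2 * L} (k + suc y) p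
  ... | z , z<N , f = fromℕ< z<N , top , trans (cong (_mod N) (trans (cong (_+ origin (fromℕ< z<N)) eq) (ring₂ k d (origin (fromℕ< z<N)))))
                        (trans (mod-+ {a = k + origin (fromℕ< z<N)} {b = toℕ p} d (trans top (sym (mod-toℕ p)))) e)
    where
    ring₁ : ∀ k z y → k + (z + y) ≡ z + (k + y)
    ring₁ = solve-∀
    ring₂ : ∀ k d o → k + d + o ≡ k + o + d
    ring₂ = solve-∀
    top : (k + origin (fromℕ< z<N)) mod N ≡ p
    top = trans (cong (_mod N) (trans (cong (λ w → k + (w + suc y)) (toℕ-fromℕ< z<N)) (ring₁ k z (suc y)))) f

  forward-joins : ∀ {i d p p′ τ} → i < L → Forward i d → Step i τ → (toℕ p + d) mod N ≡ p′ → LabelJoins p p′ τ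
  forward-joins {i} {p = p} i<L eq st e with translate {i} {p = p} i eq e
  ... | c , e₁ , e₂ = c , i , i<L , inj₁ (trans (a-< c i<L) e₁ , trans (b-< c i<L) e₂ , st)

  backward-joins : ∀ {i d p p′} → i < L → Backward i d → (toℕ p + d) mod N ≡ p′ → LabelJoins p p′ false
  backward-joins {i} {p = p} i<L eq e with translate {i} {p = p} (suc i % L) eq e
  ... | c , e₁ , e₂ = c , i , i<L , inj₂ (e₁ , trans (b-< c i<L) e₂ , refl)

  interior-joins : ∀ {d p p′} → 1 < d → d < 2 * L → (toℕ p + d) mod N ≡ p′ → LabelJoins p p′ false
  interior-joins {d} {p} 1<d d<2L e with interior d 1<d d<2L
  ... | i , i<L , inj₁ (eq , st) = forward-joins {p = p} i<L eq st e
  ... | i , i<L , inj₂ eq        = backward-joins {p = p} i<L eq e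

  -- The two orders have differences `d` and `N - d`. Those of the second-kind edges, 1 and 2L, are
  -- opposite modulo `N`, so both orders are of the second kind or neither is.
  label-joins-< : ∀ p p′ → toℕ p < toℕ p′ → ∃ λ τ → LabelJoins p p′ τ × LabelJoins p′ p τ
  label-joins-< p p′ p<p′ with difference (<⇒≤ p<p′)
  ... | d , p+d = go (<-cmp d 1) (<-cmp d (2 * L)) (difference {d} {N} (<⇒≤ d<N))
    where
    d<N : d < N
    d<N = ≤-<-trans (≤-trans (m≤n+m d (toℕ p)) (≤-reflexive p+d)) (toℕ<n p′)
    up : (toℕ p + d) mod N ≡ p′
    up = trans (cong (_mod N) p+d) (mod-toℕ p′)
    down : ∀ e → d + e ≡ N → (toℕ p′ + e) mod N ≡ p
    down e d+e = trans (mod-cong 0 1 (trans (+-identityʳ _) (trans (cong (_+ e) (sym p+d)) (trans (+-assoc (toℕ p) d e) (cong (toℕ p +_) (trans d+e (sym (+-identityʳ N)))))))) (mod-toℕ p)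
    first : ∀ {p p′} → (toℕ p + 2 * L) mod N ≡ p′ → LabelJoins p p′ true
    first {p} e = forward-joins {p = p} (<-trans z<s 1<L) forward-first (step-first 1<L) e
    final : ∀ {p p′} → (toℕ p + 1) mod N ≡ p′ → LabelJoins p p′ true
    final {p} e = forward-joins {p = p} last<L forward-last (step-last (<-≤-trans z<s (m≤n+m y y′)) last-suc) e
    go : _ → _ → ∃ (λ e → d + e ≡ N) → ∃ λ τ → LabelJoins p p′ τ × LabelJoins p′ p τ
    go (tri< d<1 _ _) _ _ = contradiction (trans (sym (+-identityʳ (toℕ p))) (trans (cong (toℕ p +_) (sym (n<1⇒n≡0 d<1))) p+d)) (<⇒≢ p<p′)
    go (tri≈ _ refl _) _ (e , d+e) = true , final {p} up , first {p′} (trans (cong (λ w → (toℕ p′ + w) mod N) (suc-injective (sym d+e))) (down e d+e))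
    go _ (tri> _ _ d>) _ = contradiction d<N (≤⇒≯ d>)
    go _ (tri≈ _ refl _) (e , d+e) = true , first {p} up , final {p′} (trans (cong (λ w → (toℕ p′ + w) mod N) (sym (+-cancelˡ-≡ (2 * L) e 1 (trans d+e (+-comm 1 (2 * L)))))) (down e d+e))
    go (tri> _ _ 1<d) (tri< d<2L _ _) (e , d+e) = false , interior-joins {p = p} 1<d d<2L up , interior-joins {p = p′} 1<e e<2L (down e d+e)
      where
      1<e : 1 < e
      1<e = +-cancelˡ-< d 1 e (subst (d + 1 <_) (sym d+e) (≤-<-trans (≤-reflexive (+-comm d 1)) (s≤s d<2L)))
      e<2L : e < 2 * L
      e<2L = ≤-pred (subst (suc e <_) d+e (+-monoˡ-< e 1<d))

  label-joins : ∀ p p′ → p ≢ p′ → ∃ λ τ → LabelJoins p p′ τ × LabelJoins p′ p τ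
  label-joins p p′ p≢p′ with <-cmp (toℕ p) (toℕ p′)
  ... | tri< lt _ _ = label-joins-< p p′ lt
  ... | tri≈ _ eq _ = contradiction (toℕ-injective eq) p≢p′
  ... | tri> _ _ gt with label-joins-< p′ p gt
  ...   | τ , j , j′ = τ , j′ , j

-- Near-factors of K_u on the groups and the point at infinity

flip : Fin 2 → Fin 2
flip zero    = suc zero
flip (suc _) = zero

-- The orthogonal array OA(4,3,2): the columns p₁, p₂ and p₁ + p₂ of 𝔽₂².
column : Fin 3 → Fin 2 → Fin 2 → Fin 2
column zero          p₁ p₂       = p₁
column (suc zero)    p₁ p₂       = p₂
column (suc (suc _)) zero p₂     = p₂
column (suc (suc _)) (suc _) p₂  = flip p₂

-- Two different columns are independent linear forms on 𝔽₂², so they take every pair of values;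
-- `flip` only permutes the values. The finitely many cases are decided by computation.
orthogonal : ∀ κ κ′ → κ ≢ κ′ → ∀ t t′ → ∃₂ λ p₁ p₂ → column κ p₁ p₂ ≡ t × flip (column κ′ p₁ p₂) ≡ t′
orthogonal = toWitness {a? = all? λ κ → all? λ κ′ → ¬? (κ ≟ᶠ κ′) →-dec all? λ t → all? λ t′ →
  any? λ p₁ → any? λ p₂ → (column κ p₁ p₂ ≟ᶠ t) ×-dec (flip (column κ′ p₁ p₂) ≟ᶠ t′)} _

halfOf : ∀ (t w : Fin 2) → w ≡ t ⊎ w ≡ flip t
halfOf zero       zero       = inj₁ refl
halfOf zero       (suc zero) = inj₂ refl
halfOf (suc zero) zero       = inj₂ refl
halfOf (suc zero) (suc zero) = inj₁ refl

module Frame {X : ℕ} (S : ArcSystem X) (y′ : ℕ) where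

  open ArcSystem S
  open Rosa y′
  open Level L

  -- `nothing` is the point at infinity; a group consists of two halves, each a copy of ℤ_L.
  Point : Set
  Point = Maybe (Fin X × Fin 2 × Fin L)

  place : Fin X → Fin N → Point
  place j zero    = nothing
  place j (suc c) = just (j , remQuot {2} L c)

  label : Fin 2 → Fin L → Fin N
  label w e = suc (combine w e)

  place-label : ∀ j w e → place j (label w e) ≡ just (j , w , e)
  place-label j w e = cong (λ p → just (j , p)) (remQuot-combine w e)

  place-injective : ∀ j {p q} → place j p ≡ place j q → p ≡ q
  place-injective j {zero}  {zero}  _  = refl
  place-injective j {suc p} {suc q} eq = cong suc (trans (sym (combine-remQuot {2} L p))
    (trans (cong (λ (w , e) → combine w e) (,-injectiveʳ (just-injective eq))) (combine-remQuot {2} L q)))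

  local : Fin X → Fin N → Walk Point L
  local j c = record
    { A          = place j ∘ a c
    ; B          = place j ∘ b c
    ; A-periodic = λ n → cong (place j) (a-periodic c n)
    ; B-periodic = λ n → cong (place j) (b-periodic c n)
    ; A≢B        = λ n → a≢b c n ∘ place-injective j
    ; B≢A        = λ n → b≢a c n ∘ place-injective j
    }

  -- The parameter n is the coordinate in the group of smaller index, whichever of the two groups
  -- holds the a-vertices; this makes the type of an edge symmetric.
  offset offset′ : ∀ {j k : ℕ} → Fin y → Dec (j < k) → ℕ
  offset  m (yes _) = 0
  offset  m (no _)  = 2 * toℕ m + 1
  offset′ m (yes _) = 2 * toℕ m + 1
  offset′ m (no _)  = 0

  module _ (i j : Fin X) (p₁ p₂ : Fin 2) (m : Fin y) where

    private
      d = toℕ j <? toℕ (σ i j)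

    -- A Hamiltonian cycle between two halves: positions differ by 2m+1 on the edges aₙbₙ and by an
    -- adjacent even number on the others. The flip in `frameB` leaves the first half of each group
    -- to the arc that starts there.
    frameA frameB : ℕ → Point
    frameA n = just (j , column (colour i j) p₁ p₂ , (n + offset m d) mod L)
    frameB n = just (σ i j , flip (column (colour i (σ i j)) p₁ p₂) , (n + offset′ m d) mod L)

  frame : ∀ i j → i ≢ j → Fin 2 → Fin 2 × Fin y → Walk Point L
  frame i j i≢j p₁ (p₂ , m) = record
    { A          = frameA i j p₁ p₂ m
    ; B          = frameB i j p₁ p₂ m
    ; A-periodic = λ n → cong (λ z → just (j , _ , z)) (periodic n _)
    ; B-periodic = λ n → cong (λ z → just (σ i j , _ , z)) (periodic n _)
    ; A≢B        = λ n eq → σ-≢ i j i≢j (sym (,-injectiveˡ (just-injective eq)))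
    ; B≢A        = λ n eq → σ-≢ i j i≢j (,-injectiveˡ (just-injective eq))
    }
    where
    ring : ∀ n o L → n + L + o + 0 ≡ n + o + 1 * L
    ring = solve-∀
    periodic : ∀ n o → (n + L + o) mod L ≡ (n + o) mod L
    periodic n o = mod-cong {L} {n + L + o} {n + o} 0 1 (ring n o L)

  -- The coordinates of the missed point serve as parameters: its half is `p₁`, and its position
  -- splits into `p₂` and `m`. So the near-factors missing points of group `i` realise every
  -- parameter choice.
  select : ∀ i w (e : Fin L) j → Dec (i ≡ j) → Walk Point L
  select i w e j (yes _)   = local j (label w e)
  select i w e j (no i≢j) = frame i j i≢j w (remQuot {2} y e)

  walk : Point → Fin X → Walk Point L
  walk nothing            j = local j zero
  walk (just (i , w , e)) j = select i w e j (i ≟ᶠ j)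

  select-refl : ∀ i w e d → select i w e i d ≡ local i (label w e)
  select-refl i w e (yes _) = refl
  select-refl i w e (no n)  = contradiction refl n

  walk-place : ∀ j c → walk (place j c) j ≡ local j c
  walk-place j zero    = refl
  walk-place j (suc c) = trans (select-refl j _ _ (j ≟ᶠ j)) (cong (local j ∘ suc) (combine-remQuot {2} L c))

  walk-label : ∀ i w e → walk (just (i , w , e)) i ≡ local i (label w e)
  walk-label i w e = select-refl i w e (i ≟ᶠ i)

  CoveredBy : Walk Point L → Point → Set
  CoveredBy ω v = ∃ λ n → n < L × (Walk.A ω n ≡ v ⊎ Walk.B ω n ≡ v)

  local-covers : ∀ j c p → p ≢ c → CoveredBy (local j c) (place j p)
  local-covers j c p p≢c with label-covered c p p≢c
  ... | n , n<L , inj₁ e = n , n<L , inj₁ (cong (place j) e)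
  ... | n , n<L , inj₂ e = n , n<L , inj₂ (cong (place j) e)

  label-injective : ∀ {w e w′ e′} → label w e ≡ label w′ e′ → (w , e) ≡ (w′ , e′)
  label-injective {w} {e} {w′} {e′} eq with combine-injective w e w′ e′ (sucᶠ-injective eq)
  ... | refl , refl = refl

  select-covers-A : ∀ i w e j w′ e′ d → i ≢ j →
    w′ ≡ column (colour i j) w (proj₁ (remQuot {2} y e)) → CoveredBy (select i w e j d) (just (j , w′ , e′))
  select-covers-A i w e j w′ e′ (yes i≡j) i≢j _ = contradiction i≡j i≢j
  select-covers-A i w e j w′ e′ (no _) i≢j refl
    with mod-subtract (offset (proj₂ (remQuot {2} y e)) (toℕ j <? toℕ (σ i j))) e′
  ... | n , n<L , eq = n , n<L , inj₁ (cong (λ z → just (j , _ , z)) eq)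

  select-covers-B : ∀ i w e j w′ e′ d → i ≢ j →
    w′ ≡ flip (column (colour i (σ i j)) w (proj₁ (remQuot {2} y e))) → CoveredBy (select i w e j d) (just (σ i j , w′ , e′))
  select-covers-B i w e j w′ e′ (yes i≡j) i≢j _ = contradiction i≡j i≢j
  select-covers-B i w e j w′ e′ (no _) i≢j refl
    with mod-subtract (offset′ (proj₂ (remQuot {2} y e)) (toℕ j <? toℕ (σ i j))) e′
  ... | n , n<L , eq = n , n<L , inj₂ (cong (λ z → just (σ i j , _ , z)) eq)

  -- The local cycle covers the rest of the group of the hole and the point at infinity. In any
  -- other group one half lies on the arc leaving it and the other on the arc entering it. If
  -- infinity is the hole, every group has a local cycle.
  walk-covers : ∀ h v → v ≢ h → Covers walk h v
  walk-covers nothing nothing v≢h = contradiction refl v≢h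
  walk-covers nothing (just (j , w , e)) _ =
    j , subst (CoveredBy (local j zero)) (place-label j w e) (local-covers j zero (label w e) (λ ()))
  walk-covers (just (i , w , e)) nothing _ =
    i , subst (λ ω → CoveredBy ω nothing) (sym (walk-label i w e)) (local-covers i (label w e) zero (λ ()))
  walk-covers (just (i , w , e)) (just (j , w′ , e′)) v≢h with i ≟ᶠ j
  ... | yes refl = i , subst (λ ω → CoveredBy ω (just (i , w′ , e′))) (sym (walk-label i w e))
          (subst (CoveredBy (local i (label w e))) (place-label i w′ e′)
            (local-covers i (label w e) (label w′ e′) (λ eq → v≢h (cong (λ p → just (i , p)) (label-injective eq)))))
  ... | no i≢j with halfOf (column (colour i j) w (proj₁ (remQuot {2} y e))) w′
  ...   | inj₁ A-half = j , select-covers-A i w e j w′ e′ (i ≟ᶠ j) i≢j A-half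
  ...   | inj₂ B-half with σ-onto i j i≢j
  ...     | j₀ , i≢j₀ , refl = j₀ , select-covers-B i w e j₀ w′ e′ (i ≟ᶠ j₀) i≢j₀ B-half

  local-joins : ∀ {j p p′ τ} → LabelJoins p p′ τ → Joins walk (place j p) (place j p′) τ
  local-joins {j} {p} {p′} {τ} (c , i , i<L , k) = place j c , j , i , i<L , subst
    (λ ω → (Walk.A ω i ≡ place j p × Walk.B ω i ≡ place j p′ × Step i τ)
         ⊎ (Walk.A ω (suc i) ≡ place j p × Walk.B ω i ≡ place j p′ × τ ≡ false))
    (sym (walk-place j c)) (go k)
    where
    go : _ → _
    go (inj₁ (e₁ , e₂ , st)) = inj₁ (cong (place j) e₁ , cong (place j) e₂ , st)
    go (inj₂ (e₁ , e₂ , t))  = inj₂ (cong (place j) e₁ , cong (place j) e₂ , t)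

  Both : Point → Point → Set
  Both v w = ∃ λ τ → Joins walk v w τ × Joins walk w v τ

  both-sym : ∀ {v w} → Both v w → Both w v
  both-sym (τ , j , j′) = τ , j′ , j

  both-local : ∀ j {p p′} → p ≢ p′ → Both (place j p) (place j p′)
  both-local j {p} {p′} p≢p′ with label-joins p p′ p≢p′
  ... | τ , k , k′ = τ , local-joins {j} k , local-joins {j} k′

  FrameJoins : Fin X → Fin L → Fin X → Fin L → Fin y → Bool → Set
  FrameJoins j e j′ e′ m τ = ∃ λ n → n < L ×
    (((n + offset m d) mod L ≡ e × (n + offset′ m d) mod L ≡ e′ × Step n τ)
     ⊎ ((suc n + offset m d) mod L ≡ e × (n + offset′ m d) mod L ≡ e′ × τ ≡ false))
    where d = toℕ j <? toℕ j′

  -- `σ-link` gives the `i` with the arc from `j` to `j′`, and orthogonality the parameters that put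
  -- the halves `w` and `w′` on it; only the positions remain.
  frame-joins : ∀ {j j′ e e′ m τ} → j ≢ j′ → ∀ w w′ → FrameJoins j e j′ e′ m τ →
                Joins walk (just (j , w , e)) (just (j′ , w′ , e′)) τ
  frame-joins {j} {j′} {e} {e′} {m} {τ} j≢j′ w w′ (n , n<L , k) with σ-link j j′ j≢j′
  ... | i , i≢j , refl with orthogonal (colour i j) (colour i j′) (proper i j i≢j) w w′
  ...   | p₁ , p₂ , refl , refl = just (i , p₁ , combine p₂ m) , j , n , n<L , chosen (i ≟ᶠ j)
    where
    Goal : Walk Point L → Set
    Goal ω = (Walk.A ω n ≡ just (j , w , e) × Walk.B ω n ≡ just (σ i j , w′ , e′) × Step n τ)
           ⊎ (Walk.A ω (suc n) ≡ just (j , w , e) × Walk.B ω n ≡ just (σ i j , w′ , e′) × τ ≡ false)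
    go : _ → Goal (frame i j i≢j p₁ (p₂ , m))
    go (inj₁ (e₁ , e₂ , st)) = inj₁ (cong (λ z → just (j , _ , z)) e₁ , cong (λ z → just (σ i j , _ , z)) e₂ , st)
    go (inj₂ (e₁ , e₂ , t))  = inj₂ (cong (λ z → just (j , _ , z)) e₁ , cong (λ z → just (σ i j , _ , z)) e₂ , t)
    chosen : ∀ d → Goal (select i p₁ (combine p₂ m) j d)
    chosen (yes i≡j) = contradiction i≡j i≢j
    chosen (no i≢j′) = subst (λ pm → Goal (frame i j i≢j′ p₁ pm)) (sym (remQuot-combine p₂ m)) (go k)

  private
    offset-yes : ∀ {j k} m (d : Dec (j < k)) → j < k → offset m d ≡ 0 × offset′ m d ≡ 2 * toℕ m + 1
    offset-yes m (yes _) _ = refl , refl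
    offset-yes m (no n)  p = contradiction p n

    offset-no : ∀ {j k} m (d : Dec (k < j)) → j < k → offset m d ≡ 2 * toℕ m + 1 × offset′ m d ≡ 0
    offset-no m (yes q) p = contradiction q (<-asym p)
    offset-no m (no _)  _ = refl , refl

  frame-joins-up : ∀ {j j′} → toℕ j < toℕ j′ → ∀ e e′ m τ → (∃ λ n → n < L ×
    (((n + 0) mod L ≡ e × (n + (2 * toℕ m + 1)) mod L ≡ e′ × Step n τ)
     ⊎ ((suc n + 0) mod L ≡ e × (n + (2 * toℕ m + 1)) mod L ≡ e′ × τ ≡ false))) → FrameJoins j e j′ e′ m τ
  frame-joins-up {j} {j′} j<j′ e e′ m τ k
    with offset m (toℕ j <? toℕ j′) | offset′ m (toℕ j <? toℕ j′) | offset-yes m (toℕ j <? toℕ j′) j<j′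
  ... | _ | _ | refl , refl = k

  frame-joins-down : ∀ {j j′} → toℕ j < toℕ j′ → ∀ e e′ m τ → (∃ λ n → n < L ×
    (((n + (2 * toℕ m + 1)) mod L ≡ e′ × (n + 0) mod L ≡ e × Step n τ)
     ⊎ ((suc n + (2 * toℕ m + 1)) mod L ≡ e′ × (n + 0) mod L ≡ e × τ ≡ false))) → FrameJoins j′ e′ j e m τ
  frame-joins-down {j} {j′} j<j′ e e′ m τ k
    with offset m (toℕ j′ <? toℕ j) | offset′ m (toℕ j′ <? toℕ j) | offset-no m (toℕ j′ <? toℕ j) j<j′
  ... | _ | _ | refl , refl = k

  plus0 : ∀ (e : Fin L) → (toℕ e + 0) mod L ≡ e
  plus0 e = trans (cong (_mod L) (+-identityʳ (toℕ e))) (mod-toℕ e)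

  -- 2m ≡ 2m′ + 2 (mod L), where m′ = m − 1 in ℤ_y.
  predecessor : ∀ (m : Fin y) → ∃ λ m′ → ∀ e → (suc e + (2 * toℕ m′ + 1)) mod L ≡ (e + 2 * toℕ m) mod L
  predecessor m with mod-subtract {y′} 1 m
  ... | k , k<y , eq with mod-cancel {y} {k + 1} {toℕ m} (trans eq (sym (mod-toℕ m)))
  ...   | p , q , eq′ = fromℕ< k<y , λ e → mod-cong p q (begin
    suc e + (2 * toℕ (fromℕ< k<y) + 1) + p * L ≡⟨ cong (λ w → suc e + (2 * w + 1) + p * L) (toℕ-fromℕ< k<y) ⟩
    suc e + (2 * k + 1) + p * L                ≡⟨ ring₁ e k p y ⟩
    e + 2 * (k + 1 + p * y)                    ≡⟨ cong (λ w → e + 2 * w) eq′ ⟩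
    e + 2 * (toℕ m + q * y)                    ≡⟨ ring₂ e (toℕ m) q y ⟩
    e + 2 * toℕ m + q * L                      ∎)
    where
    open ≡-Reasoning
    ring₁ : ∀ e k p y → suc e + (2 * k + 1) + p * (2 * y) ≡ e + 2 * (k + 1 + p * y)
    ring₁ = solve-∀
    ring₂ : ∀ e m q y → e + 2 * (m + q * y) ≡ e + 2 * m + q * (2 * y)
    ring₂ = solve-∀

  -- An odd difference of positions is that of an edge aₙbₙ; both orders then use n = `e`, hence the
  -- same type. An even one belongs to edges of type `false`, with parameter `m` in one order and
  -- its predecessor in the other.
  both-frame-< : ∀ {j j′} → toℕ j < toℕ j′ → ∀ w e w′ e′ → Both (just (j , w , e)) (just (j′ , w′ , e′))
  both-frame-< {j} {j′} j<j′ w e w′ e′ with mod-subtract (toℕ e) e′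
  ... | z , z<L , eq = go (even⊎odd z)
    where
    j≢j′ : j ≢ j′
    j≢j′ refl = <-irrefl refl j<j′
    go : _ → Both (just (j , w , e)) (just (j′ , w′ , e′))
    go (inj₂ (k , refl)) with step 1<L (toℕ<n e)
    ... | τ , st = τ
      , frame-joins j≢j′ w w′ (frame-joins-up j<j′ e e′ m τ (toℕ e , toℕ<n e , inj₁ (plus0 e , across , st)))
      , frame-joins (j≢j′ ∘ sym) w′ w (frame-joins-down j<j′ e e′ m τ (toℕ e , toℕ<n e , inj₁ (across , plus0 e , st)))
      where
      k<y : k < y
      k<y = *-cancelˡ-< 2 k y (<-trans (n<1+n (2 * k)) z<L)
      m = fromℕ< k<y
      ring : ∀ e k → e + (2 * k + 1) ≡ suc (2 * k) + e
      ring = solve-∀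
      across : (toℕ e + (2 * toℕ m + 1)) mod L ≡ e′
      across = trans (cong (_mod L) (trans (cong (λ w → toℕ e + (2 * w + 1)) (toℕ-fromℕ< k<y)) (ring (toℕ e) k))) eq
    go (inj₁ (k , refl)) with mod-subtract 1 e | predecessor (fromℕ< (*-cancelˡ-< 2 k y z<L))
    ... | n , n<L , n+1 | m′ , pred = false
      , frame-joins j≢j′ w w′ (frame-joins-up j<j′ e e′ m false (n , n<L , inj₂ (trans (cong (_mod L) (ring₁ n)) n+1 , across , refl)))
      , frame-joins (j≢j′ ∘ sym) w′ w (frame-joins-down j<j′ e e′ m′ false (toℕ e , toℕ<n e , inj₂ (trans (pred (toℕ e)) across′ , plus0 e , refl)))
      where
      k<y : k < y
      k<y = *-cancelˡ-< 2 k y z<L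
      m = fromℕ< k<y
      ring₁ : ∀ n → suc n + 0 ≡ n + 1
      ring₁ = solve-∀
      ring₂ : ∀ n k → n + (2 * k + 1) ≡ n + 1 + 2 * k
      ring₂ = solve-∀
      across′ : (toℕ e + 2 * toℕ m) mod L ≡ e′
      across′ = trans (cong (_mod L) (trans (cong (λ w → toℕ e + 2 * w) (toℕ-fromℕ< k<y)) (+-comm (toℕ e) (2 * k)))) eq
      across : (n + (2 * toℕ m + 1)) mod L ≡ e′
      across = trans (cong (_mod L) (ring₂ n (toℕ m)))
        (trans (mod-+ {L} {n + 1} {toℕ e} (2 * toℕ m) (trans n+1 (sym (mod-toℕ e)))) across′)

  walk-joins : ∀ v w → v ≢ w → Both v w
  walk-joins nothing nothing v≢w = contradiction refl v≢w
  walk-joins nothing (just (j , w , e)) _ = subst (Both nothing) (place-label j w e) (both-local j {zero} {label w e} (λ ()))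
  walk-joins (just (j , w , e)) nothing _ = subst (λ v → Both v nothing) (place-label j w e) (both-local j {label w e} {zero} (λ ()))
  walk-joins (just (j , w , e)) (just (j′ , w′ , e′)) v≢w with <-cmp (toℕ j) (toℕ j′)
  ... | tri< lt _ _ = both-frame-< lt w e w′ e′
  ... | tri> _ _ gt = both-sym (both-frame-< gt w′ e′ w e)
  ... | tri≈ _ eq _ with toℕ-injective eq
  ...   | refl = subst (λ v → Both v (just (j , w′ , e′))) (place-label j w e)
                   (subst (Both (place j (label w e))) (place-label j w′ e′)
                     (both-local j {label w e} {label w′ e′} (λ eq → v≢w (cong (λ p → just (j , p)) (label-injective eq)))))

  base : Base Point X L
  base = record { walk = walk ; covers = walk-covers ; joins = walk-joins }

-- Relabelling the points and choosing the parameters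

module _ {V V′ : Set} (f : V → V′) (g : V′ → V) (fg : ∀ v → f (g v) ≡ v) (gf : ∀ v → g (f v) ≡ v) where

  private
    f-injective : ∀ {v w} → f v ≡ f w → v ≡ w
    f-injective eq = trans (sym (gf _)) (trans (cong g eq) (gf _))

    g-injective : ∀ {v w} → g v ≡ g w → v ≡ w
    g-injective eq = trans (sym (fg _)) (trans (cong f eq) (fg _))

  relabel-walk : ∀ {L} → Walk V L → Walk V′ L
  relabel-walk ω = record
    { A          = f ∘ A
    ; B          = f ∘ B
    ; A-periodic = cong f ∘ A-periodic
    ; B-periodic = cong f ∘ B-periodic
    ; A≢B        = λ i → A≢B i ∘ f-injective
    ; B≢A        = λ i → B≢A i ∘ f-injective
    }
    where open Walk ω

  relabel : ∀ {X L} .{{_ : NonZero L}} → Base V X L → Base V′ X L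
  relabel {X} {L} β = record
    { walk   = walk′
    ; covers = λ h v v≢h → move-covers h v (covers (g h) (g v) (v≢h ∘ g-injective))
    ; joins  = λ v w v≢w → let τ , j , j′ = joins (g v) (g w) (v≢w ∘ g-injective) in τ , move-joins v w j , move-joins w v j′
    }
    where
    open Base β
    walk′ : V′ → Fin X → Walk V′ L
    walk′ h κ = relabel-walk (walk (g h) κ)
    back : ∀ {v w} → v ≡ g w → f v ≡ w
    back e = trans (cong f e) (fg _)
    move-covers : ∀ h v → Covers walk (g h) (g v) → Covers walk′ h v
    move-covers h v (κ , i , i<L , inj₁ e) = κ , i , i<L , inj₁ (back e)
    move-covers h v (κ , i , i<L , inj₂ e) = κ , i , i<L , inj₂ (back e)
    move-joins : ∀ v w {τ} → Joins walk (g v) (g w) τ → Joins walk′ v w τ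
    move-joins v w {τ} (h , κ , i , i<L , k) = f h , κ , i , i<L , subst (λ h′ → Goal (walk h′ κ)) (sym (gf h)) (go k)
      where
      Goal : Walk V L → Set
      Goal ω = (f (Walk.A ω i) ≡ v × f (Walk.B ω i) ≡ w × Level.Step L i τ)
             ⊎ (f (Walk.A ω (suc i)) ≡ v × f (Walk.B ω i) ≡ w × τ ≡ false)
      go : _ → Goal (walk h κ)
      go (inj₁ (e₁ , e₂ , st)) = inj₁ (back e₁ , back e₂ , st)
      go (inj₂ (e₁ , e₂ , t))  = inj₂ (back e₁ , back e₂ , t)

module _ {x : ℕ} (0<x : 0 < x) (x≢2 : x ≢ 2) (y′ h m : ℕ) where

  open Rosa y′ using (L; 1<L)
  open Frame (arcSystem x 0<x x≢2) y′ using (Point; base)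

  encode : Point → Fin (suc (x * (2 * L)))
  encode nothing            = zero
  encode (just (j , w , e)) = suc (combine j (combine w e))

  decode : Fin (suc (x * (2 * L))) → Point
  decode zero    = nothing
  decode (suc i) = let j , c = remQuot {x} (2 * L) i in just (j , remQuot {2} L c)

  encode-decode : ∀ i → encode (decode i) ≡ i
  encode-decode zero    = refl
  encode-decode (suc i) = cong suc (trans
    (cong (combine (proj₁ (remQuot {x} (2 * L) i))) (combine-remQuot {2} L _)) (combine-remQuot {x} (2 * L) i))

  decode-encode : ∀ v → decode (encode v) ≡ v
  decode-encode nothing            = refl
  decode-encode (just (j , w , e)) = cong just (trans
    (cong (λ (j , c) → j , remQuot {2} L c) (remQuot-combine j (combine w e))) (cong (j ,_) (remQuot-combine w e)))

  ARCS-lifted : ARCS (suc (2 * h) * L * 2) (suc (x * (2 * L))) (suc (2 * h) * suc (2 * m))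
  ARCS-lifted = Lift.arcs-lifted 1<L (relabel encode decode encode-decode decode-encode base) h m

-- The square of an odd number is 1 modulo 4.
4∣m*odd⇒4∣m : ∀ m h → 4 ∣ m * suc (2 * h) → 4 ∣ m
4∣m*odd⇒4∣m m h 4∣ = ∣m+n∣m⇒∣n (subst (4 ∣_) (ring m h) (∣m⇒∣m*n (suc (2 * h)) 4∣)) (m∣m*n (m * (h * h + h)))
  where
  ring : ∀ m h → m * suc (2 * h) * suc (2 * h) ≡ 4 * (m * (h * h + h)) + m
  ring = solve-∀

ARCS-cong : ∀ {k k′ u u′ g g′} → k ≡ k′ → u ≡ u′ → g ≡ g′ → ARCS k u g → ARCS k′ u′ g′
ARCS-cong refl refl refl S = S

-- As g = s(2m+1) is odd, so is s; then 4 divides r, and r = 4y with y positive.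
ARCS-exists : ∀ r s x g → r ≢ 0 → 4 ∣ r * s → 0 < x → x ≢ 2 → g % 2 ≡ 1 → (∃ λ m → g ≡ s + m * (2 * s)) →
             ARCS (r * s) (r * x + 1) g
ARCS-exists r s x g r≢0 4∣rs 0<x x≢2 odd (m , refl) with even⊎odd s
-- An even `s` would make `g` even.
... | inj₁ (h , refl) = contradiction (trans (sym (m*n%n≡0 (h + m * (2 * h)) 2)) (trans (cong (_% 2) (ring h m)) odd)) (λ ())
  where
  ring : ∀ h m → (h + m * (2 * h)) * 2 ≡ 2 * h + m * (2 * (2 * h))
  ring = solve-∀
... | inj₂ (h , refl) with 4∣m*odd⇒4∣m r h 4∣rs
...   | divides zero    refl = contradiction refl r≢0
...   | divides (suc y) refl = ARCS-cong (ring₁ h y) (ring₂ x y) (ring₃ h m) (ARCS-lifted 0<x x≢2 y h m)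
  where
  ring₁ : ∀ h y → suc (2 * h) * (2 * suc y) * 2 ≡ suc y * 4 * suc (2 * h)
  ring₁ = solve-∀
  ring₂ : ∀ x y → suc (x * (2 * (2 * suc y))) ≡ suc y * 4 * x + 1
  ring₂ = solve-∀
  ring₃ : ∀ h m → suc (2 * h) * suc (2 * m) ≡ suc (2 * h) + m * (2 * suc (2 * h))
  ring₃ = solve-∀

theorem4p8 : (ps : List ℕ) → All Prime ps → 4 ∣ product ps →
    (i : ℕ) → 1 < i → i ≤ length ps ∸ 1 →
    (x g : ℕ) → 0 < x → x ≢ 2 →
    g % 2 ≡ 1 → (∃ λ m → g ≡ product (drop i ps) + m * (2 * product (drop i ps))) →
    ARCS (product ps) (product (take i ps) * x + 1) g
theorem4p8 ps primes 4∣k i _ _ x g 0<x x≢2 odd g≡s =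
  ARCS-cong (sym k≡rs) refl refl
    (ARCS-exists (product (take i ps)) (product (drop i ps)) x g r≢0 (subst (4 ∣_) k≡rs 4∣k) 0<x x≢2 odd g≡s)
  where
  k≡rs : product ps ≡ product (take i ps) * product (drop i ps)
  k≡rs = trans (cong product (sym (take++drop≡id i ps))) (product-++ (take i ps) (drop i ps))
  r≢0 : product (take i ps) ≢ 0
  r≢0 = ≢-nonZero⁻¹ _ {{product≢0 (All.map prime⇒nonZero (Allₚ.take⁺ i primes))}}
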